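{- Let $n$ be an even positive integer and let $G=\mathrm{Cay}(\mathbb{Z}_n,S)$ be a circulant graph of order $n$ whose generating set $S$ satisfies the following properties: (i) $S$ does not contain the involution $\frac n2$; (ii) $S$ has a subset $M$ such that $|M|=\frac n2-2$ and $m_i+m_j\ne\frac n2$ for all $m_i,m_j\in M$; (iii) the complement $S\setminus M$ generates the whole group $\mathbb{Z}_n$. Then $\chi''(G)\le\Delta(G)+3$.
   Context: All graphs are finite, simple and undirected. For a group $H$ and a symmetric generating set $S\subset H$ (that is, $s\in S$ implies $s^{ -1}\in S$) not containing the identity, the Cayley graph $\mathrm{Cay}(H,S)$ has vertex set $H$ and edges joining $g$ and $gs$ for $g\in H$, $s\in S$. A circulant graph is a Cayley graph on the cyclic group $H=\mathbb{Z}_n$, whose elements are written $0,1,\ldots,n-1$; sums of elements of $S$ are taken in $\mathbb{Z}_n$. A total coloring of $G$ is a coloring of its vertices and edges such that no two adjacent vertices, no two adjacent edges, and no edge and a vertex incident with it receive the same color; $\chi''(G)$ is the minimum number of colors in a total coloring, and $\Delta(G)$ is the maximum degree. -}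

module Defs where

open import Algebra.Core using (Op₁; Op₂)
open import Algebra.Structures using (IsGroup)
open import Data.Fin.Base using (Fin; toℕ; fromℕ<; splitAt; join; combine; funToFin; finToFun)
open import Data.Fin.Properties
  using (_≟_; any?; all?; toℕ-injective; toℕ-fromℕ<; toℕ<n; combine-injectiveˡ;
         combine-injectiveʳ; splitAt-join; finToFun-funToFin)
open import Data.Fin.Subset using (Subset; _∈_; _∉_)
open import Data.Fin.Subset.Properties using (_∈?_)
open import Data.List.Base using (length; filter; map; allFin)
open import Data.List.Extrema.Nat using (max)
open import Data.Nat.Base
  using (ℕ; zero; suc; _+_; _*_; _^_; _∸_; _≤_; z≤n; s≤s; NonZero; >-nonZero⁻¹)
open import Data.Nat.DivMod
  using (_/_; _%_; _mod_; m/n<m; %-distribˡ-+; m<n⇒m%n≡m; n%n≡0; m%n<n)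
open import Data.Nat.Properties
  using (_≤?_; ≤-antisym; ≰⇒≥; +-assoc; +-comm; m∸n+n≡m; <⇒≤)
open import Data.Product.Base using (Σ; ∃; _×_; _,_; proj₁; proj₂)
open import Data.Sum.Base using (_⊎_; inj₁; inj₂)
open import Data.Sum.Properties using (inj₁-injective; inj₂-injective)
open import Level using (0ℓ)
open import Relation.Binary.Core using (Rel)
open import Relation.Binary.Definitions using () renaming (Decidable to Decidable₂)
open import Relation.Binary.PropositionalEquality
open import Relation.Nullary using (¬_; Dec; yes; no; contradiction)
open import Relation.Nullary.Decidable using (map′; _×-dec_; _→-dec_; ¬?)
open import Relation.Unary using (Pred; Decidable)

------------------------------------------------------------------------
-- Finite simple graphs

record Graph (n : ℕ) : Set₁ where
  field
    Adj        : Rel (Fin n) 0ℓ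
    Adj?       : Decidable₂ Adj
    Adj-sym    : ∀ {u v} → Adj u v → Adj v u
    Adj-irrefl : ∀ {v} → ¬ Adj v v

module _ {n : ℕ} (G : Graph n) where
  open Graph G

  degree : Fin n → ℕ
  degree v = length (filter (Adj? v) (allFin n))

  Δ : ℕ
  Δ = max 0 (map degree (allFin n))

  -- The edge {u , v} receives the colour  edge u v ≡ edge v u ; the values of
  -- edge  at non-adjacent pairs are junk and are not constrained.
  record IsTotalColouring {k : ℕ} (vertex : Fin n → Fin k)
                          (edge : Fin n → Fin n → Fin k) : Set where
    field
      edge-sym      : ∀ u v → Adj u v → edge u v ≡ edge v u
      vertex-vertex : ∀ u v → Adj u v → vertex u ≢ vertex v
      edge-edge     : ∀ u v w → Adj u v → Adj u w → v ≢ w → edge u v ≢ edge u w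
      vertex-edge   : ∀ u v → Adj u v → vertex u ≢ edge u v

  TotallyColourable : ℕ → Set
  TotallyColourable k =
    Σ (Fin n → Fin k) λ vertex → Σ (Fin n → Fin n → Fin k) λ edge →
      IsTotalColouring vertex edge

  IsTotalChromaticNumber : ℕ → Set
  IsTotalChromaticNumber k =
    TotallyColourable k × (∀ j → TotallyColourable j → k ≤ j)

------------------------------------------------------------------------
-- Every finite graph has a total chromatic number: total colourability with k
-- colours is decidable, and n + n * n colours always suffice.

module _ {n : ℕ} (G : Graph n) where
  open Graph G

  isTotalColouring? : ∀ {k} (vertex : Fin n → Fin k) (edge : Fin n → Fin n → Fin k) →
                      Dec (IsTotalColouring G vertex edge)
  isTotalColouring? vertex edge =
    map′ (λ (a , b , c , d) → record
            { edge-sym = a ; vertex-vertex = b ; edge-edge = c ; vertex-edge = d })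
         (λ t → let open IsTotalColouring t in
            edge-sym , vertex-vertex , edge-edge , vertex-edge)
         ( all? (λ u → all? λ v → Adj? u v →-dec (edge u v ≟ edge v u))
     ×-dec all? (λ u → all? λ v → Adj? u v →-dec ¬? (vertex u ≟ vertex v))
     ×-dec all? (λ u → all? λ v → all? λ w →
             Adj? u v →-dec (Adj? u w →-dec (¬? (v ≟ w) →-dec ¬? (edge u v ≟ edge u w))))
     ×-dec all? (λ u → all? λ v → Adj? u v →-dec ¬? (vertex u ≟ edge u v)))

  isTotalColouring-cong : ∀ {k} {f f′ : Fin n → Fin k} {e e′ : Fin n → Fin n → Fin k} →
    (∀ u → f′ u ≡ f u) → (∀ u v → e′ u v ≡ e u v) →
    IsTotalColouring G f e → IsTotalColouring G f′ e′
  isTotalColouring-cong f≗ e≗ t = record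
    { edge-sym      = λ u v a → trans (e≗ u v) (trans (edge-sym u v a) (sym (e≗ v u)))
    ; vertex-vertex = λ u v a → subst₂ _≢_ (sym (f≗ u)) (sym (f≗ v)) (vertex-vertex u v a)
    ; edge-edge     = λ u v w a b v≢w →
        subst₂ _≢_ (sym (e≗ u v)) (sym (e≗ u w)) (edge-edge u v w a b v≢w)
    ; vertex-edge   = λ u v a → subst₂ _≢_ (sym (f≗ u)) (sym (e≗ u v)) (vertex-edge u v a)
    }
    where open IsTotalColouring t

  totallyColourable? : Decidable (TotallyColourable G)
  totallyColourable? k =
    map′ (λ (f , e , t) → _ , _ , t)
         (λ (f , e , t) → funToFin f , funToFin (λ u → funToFin (e u)) ,
            isTotalColouring-cong (finToFun-funToFin f)
              (λ u v → trans
                (cong (λ c → finToFun c v) (finToFun-funToFin (λ w → funToFin (e w)) u))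
                (finToFun-funToFin (e u) v))
              t)
         (any? λ (f : Fin (k ^ n)) → any? λ (e : Fin ((k ^ n) ^ n)) →
            isTotalColouring? (finToFun f) (λ u → finToFun (finToFun e u)))

  private
    pair : Fin n → Fin n → Fin (n * n)
    pair u v with toℕ u ≤? toℕ v
    ... | yes _ = combine u v
    ... | no  _ = combine v u

    pair-sym : ∀ u v → pair u v ≡ pair v u
    pair-sym u v with toℕ u ≤? toℕ v | toℕ v ≤? toℕ u
    ... | yes u≤v | yes v≤u with refl ← toℕ-injective (≤-antisym u≤v v≤u) = refl
    ... | yes _   | no  _   = refl
    ... | no  _   | yes _   = refl
    ... | no  u≰v | no  v≰u = contradiction (≰⇒≥ v≰u) u≰v

    pair-injective : ∀ u v w → pair u v ≡ pair u w → v ≡ w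
    pair-injective u v w eq with toℕ u ≤? toℕ v | toℕ u ≤? toℕ w
    ... | yes _ | yes _ = combine-injectiveʳ u v u w eq
    ... | yes _ | no  _ = trans (combine-injectiveʳ u v w u eq) (combine-injectiveˡ u v w u eq)
    ... | no  _ | yes _ = trans (combine-injectiveˡ v u u w eq) (combine-injectiveʳ v u u w eq)
    ... | no  _ | no  _ = combine-injectiveˡ v u w u eq

    join-injective : ∀ (x y : Fin n ⊎ Fin (n * n)) → join n (n * n) x ≡ join n (n * n) y → x ≡ y
    join-injective x y eq =
      trans (sym (splitAt-join n (n * n) x))
            (trans (cong (splitAt n) eq) (splitAt-join n (n * n) y))

  totallyColourable-n+n² : TotallyColourable G (n + n * n)
  totallyColourable-n+n² =
    (λ v → join n _ (inj₁ v)) , (λ u v → join n _ (inj₂ (pair u v))) , record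
      { edge-sym      = λ u v _ → cong (λ p → join n _ (inj₂ p)) (pair-sym u v)
      ; vertex-vertex = λ u v u~v eq →
          Adj-irrefl (subst (Adj u) (sym (inj₁-injective (join-injective _ _ eq))) u~v)
      ; edge-edge     = λ u v w _ _ v≢w eq →
          v≢w (pair-injective u v w (inj₂-injective (join-injective _ _ eq)))
      ; vertex-edge   = λ u v _ eq → inj₁≢inj₂ (join-injective _ _ eq)
      }
    where
    inj₁≢inj₂ : ∀ {u p} → ¬ (inj₁ {B = Fin (n * n)} u ≡ inj₂ {A = Fin n} p)
    inj₁≢inj₂ ()

least : {P : Pred ℕ 0ℓ} → Decidable P → ∀ k → P k → ∃ λ m → P m × (∀ j → P j → m ≤ j)
least P? zero    p = 0 , p , λ _ _ → z≤n
least P? (suc k) p with P? 0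
... | yes p₀ = 0 , p₀ , λ _ _ → z≤n
... | no ¬p₀ with m , q , min ← least (λ j → P? (suc j)) k p =
  suc m , q , λ { zero p₀ → contradiction p₀ ¬p₀ ; (suc j) r → s≤s (min j r) }

module _ {n : ℕ} (G : Graph n) where

  totalChromaticNumber : ∃ (IsTotalChromaticNumber G)
  totalChromaticNumber = least (totallyColourable? G) _ (totallyColourable-n+n² G)

  χ″ : ℕ
  χ″ = proj₁ totalChromaticNumber

  χ″-isTotalChromaticNumber : IsTotalChromaticNumber G χ″
  χ″-isTotalChromaticNumber = proj₂ totalChromaticNumber

------------------------------------------------------------------------
-- Cayley graphs of finite groups

module _ {n : ℕ} {_∙_ : Op₂ (Fin n)} {ε : Fin n} {_⁻¹ : Op₁ (Fin n)}
         (isGroup : IsGroup _≡_ _∙_ ε _⁻¹) where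
  open IsGroup isGroup using (assoc; identityʳ; inverseʳ)

  -- g ∈⟨ T ⟩ : g lies in the subgroup generated by T.
  data _∈⟨_⟩ : Fin n → Subset n → Set where
    gen : ∀ {T g}   → g ∈ T → g ∈⟨ T ⟩
    one : ∀ {T}     → ε ∈⟨ T ⟩
    mul : ∀ {T g h} → g ∈⟨ T ⟩ → h ∈⟨ T ⟩ → (g ∙ h) ∈⟨ T ⟩
    inv : ∀ {T g}   → g ∈⟨ T ⟩ → (g ⁻¹) ∈⟨ T ⟩

  Generates : Subset n → Set
  Generates T = ∀ g → g ∈⟨ T ⟩

  record IsCayleySet (S : Subset n) : Set where
    field
      symmetric : ∀ s → s ∈ S → (s ⁻¹) ∈ S
      ε∉S       : ε ∉ S
      generates : Generates S

  Cay : (S : Subset n) → IsCayleySet S → Graph n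
  Cay S isCayleySet = record
    { Adj        = λ g h → ∃ λ s → s ∈ S × h ≡ g ∙ s
    ; Adj?       = λ g h → any? λ s → (s ∈? S) ×-dec (h ≟ (g ∙ s))
    ; Adj-sym    = λ { {g} (s , s∈S , refl) → (s ⁻¹) , symmetric s s∈S ,
        sym (trans (assoc g s (s ⁻¹)) (trans (cong (g ∙_) (inverseʳ s)) (identityʳ g))) }
    ; Adj-irrefl = λ { {g} (s , s∈S , g≡gs) → ε∉S (subst (_∈ S) (cancel g s g≡gs) s∈S) }
    }
    where
    open IsCayleySet isCayleySet
    open IsGroup isGroup using (identityˡ; inverseˡ)
    cancel : ∀ g s → g ≡ g ∙ s → s ≡ ε
    cancel g s g≡gs = begin
      s                 ≡⟨ identityˡ s ⟨
      ε ∙ s             ≡⟨ cong (_∙ s) (inverseˡ g) ⟨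
      ((g ⁻¹) ∙ g) ∙ s  ≡⟨ assoc (g ⁻¹) g s ⟩
      (g ⁻¹) ∙ (g ∙ s)  ≡⟨ cong ((g ⁻¹) ∙_) g≡gs ⟨
      (g ⁻¹) ∙ g        ≡⟨ inverseˡ g ⟩
      ε                 ∎
      where open ≡-Reasoning

------------------------------------------------------------------------
-- The cyclic group ℤₙ on {0 , … , n - 1}

module ℤₙ (n : ℕ) .{{_ : NonZero n}} where

  infixl 6 _⊕_

  _⊕_ : Op₂ (Fin n)
  x ⊕ y = (toℕ x + toℕ y) mod n

  𝟎 : Fin n
  𝟎 = 0 mod n

  ⊖_ : Op₁ (Fin n)
  ⊖ x = (n ∸ toℕ x) mod n

  toℕ-mod : ∀ m → toℕ (m mod n) ≡ m % n
  toℕ-mod m = toℕ-fromℕ< (m%n<n m n)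

  mod-toℕ : ∀ (x : Fin n) → toℕ x mod n ≡ x
  mod-toℕ x = toℕ-injective (trans (toℕ-mod (toℕ x)) (m<n⇒m%n≡m (toℕ<n x)))

  mod-≡ : ∀ {a b} → a % n ≡ b % n → a mod n ≡ b mod n
  mod-≡ {a} {b} eq = toℕ-injective (trans (toℕ-mod a) (trans eq (sym (toℕ-mod b))))

  mod-⊕ : ∀ a b → (a mod n) ⊕ (b mod n) ≡ (a + b) mod n
  mod-⊕ a b = mod-≡ (trans
    (cong₂ (λ c d → (c + d) % n) (toℕ-mod a) (toℕ-mod b))
    (sym (%-distribˡ-+ a b n)))

  ⊕-comm : ∀ x y → x ⊕ y ≡ y ⊕ x
  ⊕-comm x y = cong (_mod n) (+-comm (toℕ x) (toℕ y))

  ⊕-assoc : ∀ x y z → (x ⊕ y) ⊕ z ≡ x ⊕ (y ⊕ z)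
  ⊕-assoc x y z = begin
    (x ⊕ y) ⊕ z                             ≡⟨ cong ((x ⊕ y) ⊕_) (mod-toℕ z) ⟨
    (x ⊕ y) ⊕ (toℕ z mod n)                 ≡⟨ mod-⊕ (toℕ x + toℕ y) (toℕ z) ⟩
    (toℕ x + toℕ y + toℕ z) mod n           ≡⟨ cong (_mod n) (+-assoc (toℕ x) (toℕ y) (toℕ z)) ⟩
    (toℕ x + (toℕ y + toℕ z)) mod n         ≡⟨ mod-⊕ (toℕ x) (toℕ y + toℕ z) ⟨
    (toℕ x mod n) ⊕ (y ⊕ z)                 ≡⟨ cong (_⊕ (y ⊕ z)) (mod-toℕ x) ⟩
    x ⊕ (y ⊕ z)                             ∎
    where open ≡-Reasoning

  ⊕-identityˡ : ∀ x → 𝟎 ⊕ x ≡ x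
  ⊕-identityˡ x = begin
    𝟎 ⊕ x              ≡⟨ cong (𝟎 ⊕_) (mod-toℕ x) ⟨
    𝟎 ⊕ (toℕ x mod n)  ≡⟨ mod-⊕ 0 (toℕ x) ⟩
    toℕ x mod n        ≡⟨ mod-toℕ x ⟩
    x                  ∎
    where open ≡-Reasoning

  ⊕-inverseˡ : ∀ x → (⊖ x) ⊕ x ≡ 𝟎
  ⊕-inverseˡ x = begin
    (⊖ x) ⊕ x                  ≡⟨ cong ((⊖ x) ⊕_) (mod-toℕ x) ⟨
    (⊖ x) ⊕ (toℕ x mod n)      ≡⟨ mod-⊕ (n ∸ toℕ x) (toℕ x) ⟩
    (n ∸ toℕ x + toℕ x) mod n  ≡⟨ cong (_mod n) (m∸n+n≡m (<⇒≤ (toℕ<n x))) ⟩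
    n mod n                    ≡⟨ mod-≡ (trans (n%n≡0 n) (sym (m<n⇒m%n≡m (>-nonZero⁻¹ n)))) ⟩
    𝟎                          ∎
    where open ≡-Reasoning

  isGroup : IsGroup _≡_ _⊕_ 𝟎 ⊖_
  isGroup = record
    { isMonoid = record
      { isSemigroup = record
        { isMagma = record { isEquivalence = isEquivalence ; ∙-cong = cong₂ _⊕_ }
        ; assoc   = ⊕-assoc
        }
      ; identity = ⊕-identityˡ , λ x → trans (⊕-comm x 𝟎) (⊕-identityˡ x)
      }
    ; inverse = ⊕-inverseˡ , λ x → trans (⊕-comm x (⊖ x)) (⊕-inverseˡ x)
    ; ⁻¹-cong = cong ⊖_
    }

  -- n / 2 as an element of ℤₙ (the involution, when n is even)
  half : Fin n
  half = fromℕ< (m/n<m n 2 (s≤s (s≤s z≤n)))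

  circulant : (S : Subset n) → IsCayleySet isGroup S → Graph n
  circulant = Cay isGroup

{-# OPTIONS --safe #-}

-- Write n = 2h. A subset D of S is chosen that is closed under ⊖, has at most one element in each
-- coset of {0, h}, has no element s with s + s = h, and is at least as large as M: given x in
-- M ∖ D, the element h - x lies in D, and m + m′ ≠ h makes this replacement injective. The edges
-- with difference in D project to edges of K_h, minus the perfect matching of the pairs
-- {a, a + h/2} if h is even, and this graph has a total colouring by h colours with all vertices
-- coloured differently: for odd h use a + b modulo h; for even h identify the residues with the
-- nonzero residues modulo h + 1 so that matched vertices become opposite, use a + b modulo h + 1,
-- and note that 0 does not occur. Pulled back to ℤₙ, it gives x and x + h, which are not adjacent,
-- the same colour. By Vizing's theorem |S ∖ D| + 1 further colours suffice for the other edges,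
-- and h + |S ∖ D| + 1 = |M| + 2 + |S ∖ D| + 1 ≤ |S| + 3.
module Submission where

open import Defs
open import Data.Nat.Base using (ℕ; NonZero; _+_; _≤_)
open import Data.Nat.DivMod using (_/_)
open import Data.Nat.Divisibility using (_∣_)
open import Data.Fin.Subset using (Subset; _∈_; _∉_; _⊆_; _─_; ∣_∣)
open import Relation.Binary.PropositionalEquality using (_≡_; _≢_)

open import Algebra.Bundles using (AbelianGroup)
import Algebra.Properties.AbelianGroup as AbelianGroupProperties
import Algebra.Properties.CommutativeSemigroup as CommutativeSemigroupProperties
import Algebra.Properties.Group as GroupProperties
open import Data.Bool.Base using (true; false)
open import Data.Empty using (⊥)
open import Data.Fin.Base using (Fin; zero; suc; toℕ; fromℕ<; _↑ˡ_; _↑ʳ_; splitAt)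
open import Data.Fin.Properties
  using (_≟_; any?; all?; 0≢1+n; suc-injective; toℕ-injective; toℕ-fromℕ<; toℕ<n; ↑ˡ-injective;
         ↑ʳ-injective; splitAt-↑ˡ; splitAt-↑ʳ)
open import Data.Fin.Subset using (inside; outside; ⊤; _-_)
open import Data.Fin.Subset.Properties
  using (_∈?_; ∣⊤∣≡n; ∣p∣≤n; ∈⊤; x∈p∧x≢y⇒x∈p-y; x∈p⇒∣p-x∣<∣p∣; drop-∷-⊆; p─q⊆p; x∈p∧x∉q⇒x∈p─q)
open import Data.List.Base using (List; []; _∷_; length; filter; map; allFin; cartesianProduct)
  renaming (tabulate to tabulateᴸ)
open import Data.List.Extrema.Nat using (xs≤max)
import Data.List.Membership.DecPropositional as DecMembership
open import Data.List.Membership.Propositional using () renaming (_∈_ to _∈ᴸ_; _∉_ to _∉ᴸ_)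
open import Data.List.Membership.Propositional.Properties
  using (∈-map⁺; ∈-allFin; ∈-cartesianProduct⁺)
open import Data.List.Relation.Unary.All using (lookup)
open import Data.List.Relation.Unary.Any using (here; there)
open import Data.Maybe.Base using (Maybe; just; nothing; fromMaybe)
open import Data.Maybe.Properties using (just-injective; ≡-dec)
open import Data.Nat.Base
  using (zero; suc; pred; _*_; _∸_; _⊓_; _<_; _>_; z≤n; s≤s; s≤s⁻¹; >-nonZero; >-nonZero⁻¹)
open import Data.Nat.DivMod
  using (_%_; _mod_; m≡m%n+[m/n]*n; m/n*n≡m; m%n<n; n%n≡0; m<n⇒m%n≡m; [m+kn]%n≡m%n;
         %-distribˡ-+; %-distribˡ-*)
open import Data.Nat.Divisibility using (divides; m%n≡0⇒n∣m)
open import Data.Nat.Properties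
  using (_<?_; ≤-trans; ≤-reflexive; <⇒≤; <⇒≢; <⇒≱; ≮⇒≥; ≤⇒≯; <-≤-trans; <-asym; <-cmp; 1+n≰n;
         n<1+n; n≤1+n; n≢0⇒n>0; m≤m+n; m≤n+m; m+n≤o⇒m≤o; m+[n∸m]≡n; m∸n+n≡m; +-suc; +-comm;
         +-identityʳ; *-identityˡ; +-mono-≤; +-mono-≤-<; +-mono-<-≤; +-monoˡ-≤; +-monoʳ-≤;
         +-cancelˡ-≡; +-cancelˡ-<; ⊓-comm; ⊓-sel; module ≤-Reasoning)
open import Data.Nat.Tactic.RingSolver using (solve-∀)
open import Data.Product.Base using (∃; _×_; _,_; proj₁; proj₂)
open import Data.Sum.Base using (_⊎_; inj₁; inj₂)
open import Data.Vec.Base using (_∷_; []; tabulate) renaming (here to hereᵛ; there to thereᵛ)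
open import Data.Vec.Properties using (lookup∘tabulate; []=⇒lookup; lookup⇒[]=)
open import Function.Base using (_∘_; id)
open import Level using (0ℓ)
open import Relation.Binary.Definitions using (tri<; tri≈; tri>)
open import Relation.Binary.PropositionalEquality
  using (refl; sym; trans; cong; cong₂; subst; subst₂; module ≡-Reasoning)
open import Relation.Nullary using (¬_; Dec; yes; no; contradiction; does)
open import Relation.Nullary.Decidable using (_×-dec_; _⊎-dec_; ¬?; dec-true)
open import Relation.Unary using (Pred; Decidable)

-- Subsets of `Fin n`, their sizes, and vertex degrees.

module _ {n : ℕ} {ℓ} {P : Pred (Fin n) ℓ} (P? : Decidable P) where

  comprehension : Subset n
  comprehension = tabulate (does ∘ P?)

  ∈-comprehension⁺ : ∀ {x} → P x → x ∈ comprehension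
  ∈-comprehension⁺ {x} px =
    lookup⇒[]= x _ (trans (lookup∘tabulate (does ∘ P?) x) (dec-true (P? x) px))

  ∈-comprehension⁻ : ∀ {x} → x ∈ comprehension → P x
  ∈-comprehension⁻ {x} x∈ with P? x | trans (sym (lookup∘tabulate (does ∘ P?) x)) ([]=⇒lookup x∈)
  ... | yes px | _  = px
  ... | no  _  | ()

-- Induction on `p`: when `zero` belongs to `p`, its image is deleted from the target, and
-- injectivity on `p` keeps all other images away from it.
injective⇒∣p∣≤∣q∣ : ∀ {m n} (p : Subset m) (q : Subset n) (f : Fin m → Fin n) →
  (∀ {x} → x ∈ p → f x ∈ q) →
  (∀ {x y} → x ∈ p → y ∈ p → f x ≡ f y → x ≡ y) →
  ∣ p ∣ ≤ ∣ q ∣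
injective⇒∣p∣≤∣q∣ []            q f maps inj = z≤n
injective⇒∣p∣≤∣q∣ (outside ∷ p) q f maps inj =
  injective⇒∣p∣≤∣q∣ p q (f ∘ suc) (maps ∘ thereᵛ)
    (λ x∈p y∈p eq → suc-injective (inj (thereᵛ x∈p) (thereᵛ y∈p) eq))
injective⇒∣p∣≤∣q∣ (inside ∷ p)  q f maps inj =
  ≤-trans (s≤s (injective⇒∣p∣≤∣q∣ p (q - f zero) (f ∘ suc)
    (λ x∈p → x∈p∧x≢y⇒x∈p-y (maps (thereᵛ x∈p))
      (λ eq → 0≢1+n (inj hereᵛ (thereᵛ x∈p) (sym eq))))
    (λ x∈p y∈p eq → suc-injective (inj (thereᵛ x∈p) (thereᵛ y∈p) eq))))
  (x∈p⇒∣p-x∣<∣p∣ (maps hereᵛ))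

∣p─q∣+∣q∣≡∣p∣ : ∀ {n} (p q : Subset n) → q ⊆ p → ∣ p ─ q ∣ + ∣ q ∣ ≡ ∣ p ∣
∣p─q∣+∣q∣≡∣p∣ []            []            q⊆p = refl
∣p─q∣+∣q∣≡∣p∣ (inside  ∷ p) (inside  ∷ q) q⊆p =
  trans (+-suc _ _) (cong suc (∣p─q∣+∣q∣≡∣p∣ p q (drop-∷-⊆ q⊆p)))
∣p─q∣+∣q∣≡∣p∣ (inside  ∷ p) (outside ∷ q) q⊆p = cong suc (∣p─q∣+∣q∣≡∣p∣ p q (drop-∷-⊆ q⊆p))
∣p─q∣+∣q∣≡∣p∣ (outside ∷ p) (outside ∷ q) q⊆p = ∣p─q∣+∣q∣≡∣p∣ p q (drop-∷-⊆ q⊆p)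
∣p─q∣+∣q∣≡∣p∣ (outside ∷ p) (inside  ∷ q) q⊆p with () ← q⊆p hereᵛ

x∈p─q⇒x∉q : ∀ {n x} (p q : Subset n) → x ∈ p ─ q → x ∉ q
x∈p─q⇒x∉q (_ ∷ p) (inside  ∷ q) (thereᵛ x∈) (thereᵛ x∈q) = x∈p─q⇒x∉q p q x∈ x∈q
x∈p─q⇒x∉q (_ ∷ p) (outside ∷ q) (thereᵛ x∈) (thereᵛ x∈q) = x∈p─q⇒x∉q p q x∈ x∈q

-- Bridges `degree`, a list length, and the size of a subset. The function `f` is there for the
-- induction on `n`.
length-filter-tabulate : ∀ {n ℓ} {A : Set} {P : Pred A ℓ} (P? : Decidable P) (f : Fin n → A) →
  length (filter P? (tabulateᴸ f)) ≡ ∣ tabulate (does ∘ P? ∘ f) ∣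
length-filter-tabulate {zero}  P? f = refl
length-filter-tabulate {suc n} P? f with does (P? (f zero))
... | true  = cong suc (length-filter-tabulate P? (f ∘ suc))
... | false = length-filter-tabulate P? (f ∘ suc)

module _ {n : ℕ} (G : Graph n) where
  open Graph G

  neighbours : Fin n → Subset n
  neighbours v = comprehension (Adj? v)

  degree≡∣neighbours∣ : ∀ v → degree G v ≡ ∣ neighbours v ∣
  degree≡∣neighbours∣ v = length-filter-tabulate (Adj? v) id

  degree≤Δ : ∀ v → degree G v ≤ Δ G
  degree≤Δ v = lookup (xs≤max 0 (map (degree G) (allFin n))) (∈-map⁺ (degree G) (∈-allFin v))

-- Vizing's theorem

module EdgeColouring {n : ℕ} (G : Graph n) (k : ℕ) where
  open Graph G

  open DecMembership (_≟_ {n}) using () renaming (_∈?_ to _∈ᴸ?_)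

  -- Partial edge colourings and the recolouring of one edge.

  PartialColouring : Set
  PartialColouring = Fin n → Fin n → Maybe (Fin k)

  Missing : PartialColouring → Fin k → Fin n → Set
  Missing χ c u = ∀ v → χ u v ≢ just c

  record Proper (χ : PartialColouring) : Set where
    field
      χ-sym     : ∀ u v → χ u v ≡ χ v u
      χ-inj     : ∀ {u v w c} → χ u v ≡ just c → χ u w ≡ just c → v ≡ w
      χ-support : ∀ {u v c} → χ u v ≡ just c → Adj u v
  open Proper

  missing? : ∀ χ c u → Missing χ c u ⊎ ∃ λ v → χ u v ≡ just c
  missing? χ c u with any? (λ v → ≡-dec _≟_ (χ u v) (just c))
  ... | yes p = inj₂ p
  ... | no ¬p = inj₁ (λ v eq → ¬p (v , eq))

  SameEdge : (x y u v : Fin n) → Set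
  SameEdge x y u v = (u ≡ x × v ≡ y) ⊎ (u ≡ y × v ≡ x)

  sameEdge? : ∀ x y u v → Dec (SameEdge x y u v)
  sameEdge? x y u v = ((u ≟ x) ×-dec (v ≟ y)) ⊎-dec ((u ≟ y) ×-dec (v ≟ x))

  sameEdge-flip : ∀ {x y u v} → SameEdge x y u v → SameEdge x y v u
  sameEdge-flip (inj₁ (p , q)) = inj₂ (q , p)
  sameEdge-flip (inj₂ (p , q)) = inj₁ (q , p)

  abstract
    -- Abstract, so that later reasoning goes through `recolour-cases`. Taking `m` to be `nothing`
    -- erases the edge.
    recolour : Fin n → Fin n → Maybe (Fin k) → PartialColouring → PartialColouring
    recolour x y m χ u v with sameEdge? x y u v
    ... | yes _ = m
    ... | no  _ = χ u v

    recolour-cases : ∀ χ x y m u v → (SameEdge x y u v × recolour x y m χ u v ≡ m)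
                                   ⊎ (¬ SameEdge x y u v × recolour x y m χ u v ≡ χ u v)
    recolour-cases χ x y m u v with sameEdge? x y u v
    ... | yes e = inj₁ (e , refl)
    ... | no ¬e = inj₂ (¬e , refl)

  module _ (χ : PartialColouring) (x y : Fin n) (m : Maybe (Fin k)) where

    recolour-on : ∀ {u v} → SameEdge x y u v → recolour x y m χ u v ≡ m
    recolour-on {u} {v} e with recolour-cases χ x y m u v
    ... | inj₁ (_ , eq) = eq
    ... | inj₂ (¬e , _) = contradiction e ¬e

    recolour-off : ∀ {u v} → ¬ SameEdge x y u v → recolour x y m χ u v ≡ χ u v
    recolour-off {u} {v} ¬e with recolour-cases χ x y m u v
    ... | inj₁ (e , _)  = contradiction e ¬e
    ... | inj₂ (_ , eq) = eq

    recolour-missing-colour : ∀ {c u} → m ≢ just c → Missing χ c u → Missing (recolour x y m χ) c u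
    recolour-missing-colour {u = u} m≢c miss v eq with recolour-cases χ x y m u v
    ... | inj₁ (_ , eq′) = m≢c (trans (sym eq′) eq)
    ... | inj₂ (_ , eq′) = miss v (trans (sym eq′) eq)

    recolour-away : ∀ {u} → u ≢ x → u ≢ y → ∀ v → recolour x y m χ u v ≡ χ u v
    recolour-away u≢x u≢y v = recolour-off λ
      { (inj₁ (p , _)) → u≢x p ; (inj₂ (p , _)) → u≢y p }

    recolour-missing-away : ∀ {c u} → u ≢ x → u ≢ y →
      Missing χ c u → Missing (recolour x y m χ) c u
    recolour-missing-away u≢x u≢y miss v eq =
      miss v (trans (sym (recolour-away u≢x u≢y v)) eq)

    -- In a proper colouring `x y` is the only edge of colour `c` at either of its ends, so giving
    -- it another value frees `c` at both.
    recolour-frees : ∀ {c} → Proper χ → χ x y ≡ just c → m ≢ just c →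
      Missing (recolour x y m χ) c x × Missing (recolour x y m χ) c y
    recolour-frees {c} P χxy m≢c = freeˣ , freeʸ
      where
      freeˣ : Missing (recolour x y m χ) c x
      freeˣ v eq with recolour-cases χ x y m x v
      ... | inj₁ (_ , eq′)  = m≢c (trans (sym eq′) eq)
      ... | inj₂ (¬e , eq′) = ¬e (inj₁ (refl , χ-inj P (trans (sym eq′) eq) χxy))
      freeʸ : Missing (recolour x y m χ) c y
      freeʸ v eq with recolour-cases χ x y m y v
      ... | inj₁ (_ , eq′)  = m≢c (trans (sym eq′) eq)
      ... | inj₂ (¬e , eq′) =
        ¬e (inj₂ (refl , χ-inj P (trans (sym eq′) eq) (trans (χ-sym P y x) χxy)))

    -- The condition on `m` is vacuous for `nothing`, so this covers erasing an edge as well as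
    -- colouring it.
    recolour-proper : Proper χ → Adj x y →
      (∀ {c} → m ≡ just c → Missing χ c x × Missing χ c y) → Proper (recolour x y m χ)
    recolour-proper P x~y miss = record { χ-sym = symm ; χ-inj = inj ; χ-support = supp }
      where
      missing-end : ∀ {u v w c} → SameEdge x y u v → m ≡ just c → χ u w ≢ just c
      missing-end (inj₁ (refl , _)) eq = proj₁ (miss eq) _
      missing-end (inj₂ (refl , _)) eq = proj₂ (miss eq) _

      sameEdge-inj : ∀ {u v w} → SameEdge x y u v → SameEdge x y u w → v ≡ w
      sameEdge-inj (inj₁ (_ , refl)) (inj₁ (_ , refl)) = refl
      sameEdge-inj (inj₂ (_ , refl)) (inj₂ (_ , refl)) = refl
      sameEdge-inj (inj₁ (refl , _)) (inj₂ (refl , _)) = contradiction x~y Adj-irrefl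
      sameEdge-inj (inj₂ (refl , _)) (inj₁ (refl , _)) = contradiction x~y Adj-irrefl

      symm : ∀ u v → recolour x y m χ u v ≡ recolour x y m χ v u
      symm u v with recolour-cases χ x y m u v
      ... | inj₁ (e , eq)  = trans eq (sym (recolour-on (sameEdge-flip e)))
      ... | inj₂ (¬e , eq) =
        trans eq (trans (χ-sym P u v) (sym (recolour-off (¬e ∘ sameEdge-flip))))

      inj : ∀ {u v w c} → recolour x y m χ u v ≡ just c → recolour x y m χ u w ≡ just c → v ≡ w
      inj {u} {v} {w} uv uw with recolour-cases χ x y m u v | recolour-cases χ x y m u w
      ... | inj₁ (e , _)  | inj₁ (e′ , _)  = sameEdge-inj e e′
      ... | inj₁ (e , p)  | inj₂ (_ , q)   =
        contradiction (trans (sym q) uw) (missing-end e (trans (sym p) uv))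
      ... | inj₂ (_ , p)  | inj₁ (e , q)   =
        contradiction (trans (sym p) uv) (missing-end e (trans (sym q) uw))
      ... | inj₂ (_ , p)  | inj₂ (_ , q)   = χ-inj P (trans (sym p) uv) (trans (sym q) uw)

      supp : ∀ {u v c} → recolour x y m χ u v ≡ just c → Adj u v
      supp {u} {v} uv with recolour-cases χ x y m u v
      ... | inj₁ (inj₁ (refl , refl) , _) = x~y
      ... | inj₁ (inj₂ (refl , refl) , _) = Adj-sym x~y
      ... | inj₂ (_ , p) = χ-support P (trans (sym p) uv)

  -- Kempe changes.

  module _ (α β : Fin k) where

    OneOf : Maybe (Fin k) → Set
    OneOf m = m ≡ just α ⊎ m ≡ just β

    -- Only pairs coloured `α` or `β` may change, and they stay within these two colours; hence the
    -- same pairs remain coloured.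
    SameUpTo : (χ ρ : PartialColouring) → Set
    SameUpTo χ ρ = ∀ u v → ρ u v ≡ χ u v ⊎ (OneOf (χ u v) × OneOf (ρ u v))

    Kept : (χ ρ : PartialColouring) → Fin n → Set
    Kept χ ρ v = (Missing χ α v → Missing ρ α v) × (Missing χ β v → Missing ρ β v)

    Swapped : (χ ρ : PartialColouring) → Fin n → Set
    Swapped χ ρ v = (Missing χ α v → Missing ρ β v) × (Missing χ β v → Missing ρ α v)

    -- χ after exchanging α and β along an alternating path from x; e is the other end.
    record KempeChange (χ : PartialColouring) (x : Fin n) : Set where
      field
        ρ         : PartialColouring
        e         : Fin n
        ρ-proper  : Proper ρ
        same      : SameUpTo χ ρ
        swapped-x : Swapped χ ρ x
        swapped-e : Swapped χ ρ e
        kept      : ∀ v → v ≢ x → v ≢ e → Kept χ ρ v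

  swap-SameUpTo : ∀ {α β χ ρ} → SameUpTo α β χ ρ → SameUpTo β α χ ρ
  swap-SameUpTo same u v with same u v
  ... | inj₁ p       = inj₁ p
  ... | inj₂ (p , q) = inj₂ (flip p , flip q)
    where
    flip : ∀ {α β m} → OneOf α β m → OneOf β α m
    flip (inj₁ p) = inj₂ p
    flip (inj₂ p) = inj₁ p

  -- The first edge x y of the path is removed, the path is followed from y with the roles of the
  -- colours exchanged, and x y is put back with its new colour. After the removal x carries
  -- neither colour, so the set X of vertices that may carry α or β shrinks.
  kempe : ∀ t (X : Subset n) → ∣ X ∣ ≤ t → (α β : Fin k) → α ≢ β → (χ : PartialColouring) →
    Proper χ → (∀ v → v ∉ X → Missing χ α v × Missing χ β v) →
    ∀ x → Missing χ β x → KempeChange α β χ x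
  kempe t X ∣X∣≤t α β α≢β χ P out x xβ with missing? χ α x
  -- `x` carries neither colour, so the path is trivial and ends at `x` itself.
  ... | inj₁ xα = record
    { ρ = χ ; e = x ; ρ-proper = P ; same = λ _ _ → inj₁ refl
    ; swapped-x = (λ _ → xβ) , (λ _ → xα)
    ; swapped-e = (λ _ → xβ) , (λ _ → xα)
    ; kept = λ _ _ _ → id , id }
  ... | inj₂ (y , xy) with x ∈? X
  ...   | no x∉X = contradiction xy (proj₁ (out x x∉X) y)
  kempe zero X ∣X∣≤t α β α≢β χ P out x xβ | inj₂ (y , xy) | yes x∈X
    with () ← <-≤-trans (x∈p⇒∣p-x∣<∣p∣ x∈X) ∣X∣≤t
  kempe (suc t) X ∣X∣≤t α β α≢β χ P out x xβ | inj₂ (y , xy) | yes x∈X = step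
    where
    x~y : Adj x y
    x~y = χ-support P xy

    yx : χ y x ≡ just α
    yx = trans (χ-sym P y x) xy

    jβ≢jα : just β ≢ just α
    jβ≢jα = α≢β ∘ sym ∘ just-injective

    step : KempeChange α β χ x
    step with missing? χ β y
    -- `β` is missing at `y` too, so the path is the single edge `x y`.
    ... | inj₁ yβ = record
      { ρ = ρ ; e = y
      ; ρ-proper = recolour-proper χ x y (just β) P x~y (λ { refl → xβ , yβ })
      ; same = same
      ; swapped-x = (λ xα → contradiction xy (xα y)) , (λ _ → proj₁ free)
      ; swapped-e = (λ yα → contradiction yx (yα x)) , (λ _ → proj₂ free)
      ; kept = λ v v≢x v≢y → recolour-missing-away χ x y _ v≢x v≢y ,
                             recolour-missing-away χ x y _ v≢x v≢y }
      where
      ρ : PartialColouring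
      ρ = recolour x y (just β) χ
      free : Missing ρ α x × Missing ρ α y
      free = recolour-frees χ x y (just β) P xy jβ≢jα
      same : SameUpTo α β χ ρ
      same u v with recolour-cases χ x y (just β) u v
      ... | inj₂ (_ , eq) = inj₁ eq
      ... | inj₁ (inj₁ (refl , refl) , eq) = inj₂ (inj₁ xy , inj₂ eq)
      ... | inj₁ (inj₂ (refl , refl) , eq) = inj₂ (inj₁ yx , inj₂ eq)
    ... | inj₂ (z , yz) = record
      { ρ = ρ ; e = e
      ; ρ-proper = recolour-proper ρ′ x y (just β) ρ′-proper x~y (λ { refl → proj₂ x-misses , yβ })
      ; same = same
      ; swapped-x = swapped-x
      ; swapped-e = swapped
      ; kept = kept }
      where
      χ′ : PartialColouring
      χ′ = recolour x y nothing χ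

      freed : Missing χ′ α x × Missing χ′ α y
      freed = recolour-frees χ x y nothing P xy (λ ())

      keep′ : ∀ {c v} → Missing χ c v → Missing χ′ c v
      keep′ = recolour-missing-colour χ x y nothing (λ ())

      out′ : ∀ v → v ∉ X - x → Missing χ′ β v × Missing χ′ α v
      out′ v v∉ with v ≟ x
      ... | yes refl = keep′ xβ , proj₁ freed
      ... | no  v≢x  = keep′ (proj₂ (out v v∉X)) , keep′ (proj₁ (out v v∉X))
        where
        v∉X : v ∉ X
        v∉X v∈X = v∉ (x∈p∧x≢y⇒x∈p-y v∈X v≢x)

      open KempeChange (kempe t (X - x) (s≤s⁻¹ (<-≤-trans (x∈p⇒∣p-x∣<∣p∣ x∈X) ∣X∣≤t))
                          β α (α≢β ∘ sym) χ′
                          (recolour-proper χ x y nothing P x~y (λ ())) out′ y (proj₂ freed))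
        renaming (ρ to ρ′; ρ-proper to ρ′-proper; same to same′; swapped-x to swapped-y;
                  swapped-e to swapped-e′; kept to kept′)

      x≢y : x ≢ y
      x≢y refl = Adj-irrefl x~y

      -- The end `e` of the remaining path is not known to differ from `x`. In either case both
      -- colours stay missing at `x`, because `χ′` has neither there.
      x-misses : Missing ρ′ α x × Missing ρ′ β x
      x-misses with x ≟ e
      ... | yes x≡e  = proj₁ swapped-x (keep′ xβ) , proj₂ swapped-x (proj₁ freed)
        where
        swapped-x : Swapped β α χ′ ρ′ x
        swapped-x = subst (Swapped β α χ′ ρ′) (sym x≡e) swapped-e′
      ... | no  x≢e  =
        proj₂ (kept′ x x≢y x≢e) (proj₁ freed) , proj₁ (kept′ x x≢y x≢e) (keep′ xβ)

      yβ : Missing ρ′ β y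
      yβ = proj₂ swapped-y (proj₂ freed)

      ρ : PartialColouring
      ρ = recolour x y (just β) ρ′

      xα′ : Missing ρ α x
      xα′ = recolour-missing-colour ρ′ x y (just β) jβ≢jα (proj₁ x-misses)

      swapped-x : Swapped α β χ ρ x
      swapped-x = (λ xα → contradiction xy (xα y)) , (λ _ → xα′)

      swapped : Swapped α β χ ρ e
      swapped with e ≟ x | e ≟ y
      ... | yes e≡x | _ = subst (Swapped α β χ ρ) (sym e≡x) swapped-x
      -- In `χ` the vertex `y` has `α` towards `x` and `β` towards `z`, so both implications are
      -- vacuous.
      ... | no _ | yes e≡y = subst (Swapped α β χ ρ) (sym e≡y)
        ((λ yα → contradiction yx (yα x)) , (λ yβ → contradiction yz (yβ z)))
      ... | no e≢x | no e≢y =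
        recolour-missing-away ρ′ x y _ e≢x e≢y ∘ proj₂ swapped-e′ ∘ keep′ ,
        recolour-missing-away ρ′ x y _ e≢x e≢y ∘ proj₁ swapped-e′ ∘ keep′

      kept : ∀ v → v ≢ x → v ≢ e → Kept α β χ ρ v
      kept v v≢x v≢e with v ≟ y
      ... | yes refl = (λ yα → contradiction yx (yα x)) , (λ yβ → contradiction yz (yβ z))
      ... | no  v≢y  =
        recolour-missing-away ρ′ x y _ v≢x v≢y ∘ proj₂ (kept′ v v≢y v≢e) ∘ keep′ ,
        recolour-missing-away ρ′ x y _ v≢x v≢y ∘ proj₁ (kept′ v v≢y v≢e) ∘ keep′

      same : SameUpTo α β χ ρ
      same u v with recolour-cases ρ′ x y (just β) u v
      ... | inj₁ (inj₁ (refl , refl) , eq) = inj₂ (inj₁ xy , inj₂ eq)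
      ... | inj₁ (inj₂ (refl , refl) , eq) = inj₂ (inj₁ yx , inj₂ eq)
      ... | inj₂ (¬e , eq) = subst₂ (λ a b → b ≡ a ⊎ (OneOf α β a × OneOf α β b))
        (recolour-off χ x y nothing ¬e) (sym eq) (swap-SameUpTo same′ u v)

  -- Vizing fans and the colouring of one more edge.

  Coloured : PartialColouring → Fin n → Fin n → Set
  Coloured χ u v = ∃ λ c → χ u v ≡ just c

  recolour-coloured : ∀ χ x y c {u v} → Coloured χ u v → Coloured (recolour x y (just c) χ) u v
  recolour-coloured χ x y c {u} {v} (d , uv) with recolour-cases χ x y (just c) u v
  ... | inj₁ (_ , eq) = c , eq
  ... | inj₂ (_ , eq) = d , trans eq uv

  -- Colours of old edges may change; only the set of coloured pairs has to grow.
  record Extension (χ : PartialColouring) (u w : Fin n) : Set where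
    field
      ρ        : PartialColouring
      ρ-proper : Proper ρ
      extends  : ∀ {a b} → Coloured χ a b → Coloured ρ a b
      coloured : Coloured ρ u w

  extension-trans : ∀ {χ χ′ u w} → (∀ {a b} → Coloured χ a b → Coloured χ′ a b) →
    Extension χ′ u w → Extension χ u w
  extension-trans χ⇒χ′ E = record
    { ρ = ρ ; ρ-proper = ρ-proper ; extends = extends ∘ χ⇒χ′ ; coloured = coloured }
    where open Extension E

  module _ (u w₀ : Fin n) where

    -- Fan χ w ws: a Vizing fan around u from w₀ to w; ws lists its vertices before w, latest first.
    data Fan (χ : PartialColouring) : Fin n → List (Fin n) → Set where
      start : Fan χ w₀ []
      step  : ∀ {w ws w′ d} → Fan χ w ws → Missing χ d w → χ u w′ ≡ just d →
              w′ ∉ᴸ w ∷ ws → Fan χ w′ (w ∷ ws)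

    -- Here `a` comes immediately before `b` in the fan, and `c` is the colour of `u b`, which `a`
    -- misses.
    Step : ∀ {χ w ws} → Fan χ w ws → Fin n → Fin n → Fin k → Set
    Step start                                   a b c = ⊥
    Step (step {w = w} {w′ = w′} {d = d} f _ _ _) a b c =
      Step f a b c ⊎ (a ≡ w × b ≡ w′ × c ≡ d)

    module _ {χ : PartialColouring} where

      step-missing : ∀ {w ws a b c} (f : Fan χ w ws) → Step f a b c → Missing χ c a
      step-missing (step f m _ _) (inj₁ s)                    = step-missing f s
      step-missing (step f m _ _) (inj₂ (refl , refl , refl)) = m

      step-colour : ∀ {w ws a b c} (f : Fan χ w ws) → Step f a b c → χ u b ≡ just c
      step-colour (step f _ eq _) (inj₁ s)                    = step-colour f s
      step-colour (step f _ eq _) (inj₂ (refl , refl , refl)) = eq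

      step-target : ∀ {w ws a b c} (f : Fan χ w ws) → Step f a b c → b ∈ᴸ w ∷ ws
      step-target (step f _ _ _) (inj₁ s)                    = there (step-target f s)
      step-target (step f _ _ _) (inj₂ (refl , refl , refl)) = here refl

      last∉ : ∀ {w ws} → Fan χ w ws → w ∉ᴸ ws
      last∉ start           ()
      last∉ (step _ _ _ w∉) = w∉

      fan-adjacent : ∀ {w ws x} → Proper χ → Adj u w₀ → Fan χ w ws → x ∈ᴸ w ∷ ws → Adj u x
      fan-adjacent P u~w₀ start           (here refl) = u~w₀
      fan-adjacent P u~w₀ (step f _ eq _) (here refl) = χ-support P eq
      fan-adjacent P u~w₀ (step f _ _ _)  (there x∈)  = fan-adjacent P u~w₀ f x∈

      -- A fan depends on the colouring only through its steps, so it survives any change that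
      -- respects each of them.
      transfer : ∀ {ρ w ws} (f : Fan χ w ws) →
        (∀ {a b c} → Step f a b c → Missing ρ c a × ρ u b ≡ just c) → Fan ρ w ws
      transfer start            same = start
      transfer (step f _ _ w′∉) same =
        step (transfer f (same ∘ inj₁)) (proj₁ last) (proj₂ last) w′∉
        where last = same (inj₂ (refl , refl , refl))

      -- The fan cut off just before `w′`: it ends at `v`, which misses `d`, and `unique` says that
      -- no other step leads to `w′`.
      record Origin {w ws} (f : Fan χ w ws) (w′ : Fin n) (d : Fin k) : Set where
        field
          v        : Fin n
          vs       : List (Fin n)
          fan      : Fan χ v vs
          v-misses : Missing χ d v
          w′∉      : w′ ∉ᴸ v ∷ vs
          v∈       : v ∈ᴸ ws
          unique   : ∀ {a b c} → Step f a b c → b ≡ w′ → a ≡ v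

      origin : ∀ {w ws w′ d} → χ u w₀ ≡ nothing → (f : Fan χ w ws) → w′ ∈ᴸ w ∷ ws →
        χ u w′ ≡ just d → Origin f w′ d
      -- `w₀` has no predecessor, but `u w₀` is uncoloured, so `w′` cannot be `w₀`.
      origin uw₀ start (here refl) eq with () ← trans (sym uw₀) eq
      origin uw₀ (step f m eq′ w′∉) (here refl) eq = record
        { fan = f ; v-misses = subst (λ c → Missing χ c _) (just-injective (trans (sym eq′) eq)) m
        ; w′∉ = w′∉ ; v∈ = here refl
        ; unique = λ { (inj₁ s) refl → contradiction (step-target f s) w′∉
                     ; (inj₂ (a≡w , _)) _ → a≡w } }
      origin uw₀ (step f m eq′ w∉) (there w′∈) eq = record
        { fan = fan ; v-misses = v-misses ; w′∉ = w′∉ ; v∈ = there v∈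
        ; unique = λ { (inj₁ s) b≡w′ → unique s b≡w′
                     ; (inj₂ (_ , refl , _)) refl → contradiction w′∈ w∉ } }
        where open Origin (origin uw₀ f w′∈ eq)

    -- Recolouring u w with d frees at u the colour of u w, which the vertex before w misses.
    shift : ∀ {χ w ws d} → Proper χ → Adj u w₀ → Fan χ w ws →
      Missing χ d u → Missing χ d w → Extension χ u w₀
    shift {χ} {d = d} P u~w₀ start ud w₀d = record
      { ρ = recolour u w₀ (just d) χ
      ; ρ-proper = recolour-proper χ u w₀ (just d) P u~w₀ (λ { refl → ud , w₀d })
      ; extends = recolour-coloured χ u w₀ d
      ; coloured = d , recolour-on χ u w₀ (just d) (inj₁ (refl , refl)) }
    shift {χ} {w′} {d = d} P u~w₀ (step {d = d₁} f m eq w′∉) ud w′d =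
      extension-trans (recolour-coloured χ u w′ d) (shift χ₁-proper u~w₀ f₁
        (proj₁ (recolour-frees χ u w′ (just d) P eq (other ud eq)))
        (recolour-missing-colour χ u w′ (just d) (other ud eq) m))
      where
      χ₁ : PartialColouring
      χ₁ = recolour u w′ (just d) χ

      u~w′ : Adj u w′
      u~w′ = χ-support P eq

      χ₁-proper : Proper χ₁
      χ₁-proper = recolour-proper χ u w′ (just d) P u~w′ (λ { refl → ud , w′d })

      other : ∀ {c d b} → Missing χ d u → χ u b ≡ just c → just d ≢ just c
      other {b = b} ud ub d≡c = ud b (trans ub (sym d≡c))

      -- The shorter fan survives: `d` is missing at `u` and so is the colour of no step, and `w′`
      -- is not among its vertices.
      f₁ : Fan χ₁ _ _
      f₁ = transfer f λ s →
        recolour-missing-colour χ u w′ (just d) (other ud (step-colour f s)) (step-missing f s) ,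
        trans (recolour-off χ u w′ (just d) λ
                { (inj₁ (_ , refl)) → w′∉ (step-target f s)
                ; (inj₂ (refl , _)) → Adj-irrefl u~w′ })
              (step-colour f s)

  module _ {α β : Fin k} {χ ρ : PartialColouring} (same : SameUpTo α β χ ρ) where

    private
      other : ∀ {c m} → c ≢ α → c ≢ β → m ≡ just c → ¬ OneOf α β m
      other c≢α c≢β refl (inj₁ eq) = c≢α (just-injective eq)
      other c≢α c≢β refl (inj₂ eq) = c≢β (just-injective eq)

    same-colour : ∀ {c u v} → c ≢ α → c ≢ β → χ u v ≡ just c → ρ u v ≡ just c
    same-colour {u = u} {v} c≢α c≢β uv with same u v
    ... | inj₁ eq      = trans eq uv
    ... | inj₂ (i , _) = contradiction i (other c≢α c≢β uv)

    same-missing : ∀ {c u} → c ≢ α → c ≢ β → Missing χ c u → Missing ρ c u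
    same-missing {u = u} c≢α c≢β miss v uv with same u v
    ... | inj₁ eq      = miss v (trans (sym eq) uv)
    ... | inj₂ (_ , i) = contradiction i (other c≢α c≢β uv)

    -- Had the edge changed colour, it would now have `α`, which is missing at `u`.
    same-β : ∀ {u v} → Missing ρ α u → χ u v ≡ just β → ρ u v ≡ just β
    same-β {u} {v} uα uv with same u v
    ... | inj₁ eq              = trans eq uv
    ... | inj₂ (_ , inj₁ eq)   = contradiction eq (uα v)
    ... | inj₂ (_ , inj₂ eq)   = eq

    same-coloured : ∀ {u v} → Coloured χ u v → Coloured ρ u v
    same-coloured {u} {v} (c , uv) with same u v
    ... | inj₁ eq            = c , trans eq uv
    ... | inj₂ (_ , inj₁ eq) = α , eq
    ... | inj₂ (_ , inj₂ eq) = β , eq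

  module _ (free : ∀ {χ} → Proper χ → ∀ v → ∃ λ c → Missing χ c v) where

    module _ {χ : PartialColouring} (P : Proper χ) {u w₀ : Fin n}
             (u~w₀ : Adj u w₀) (uw₀ : χ u w₀ ≡ nothing) where

      -- The fan closes up: d, missing at w, is the colour of u w′ for an earlier w′, so it is also
      -- missing at the vertex v before w′. Since u, v and w are not all ends of one
      -- c/d-alternating path, exchanging c and d from w makes a colour missing at both u and v,
      -- or at both u and w.
      close : ∀ {w ws w′ c d} (f : Fan u w₀ χ w ws) → Missing χ c u → Missing χ d w →
        χ u w′ ≡ just d → w′ ∈ᴸ w ∷ ws → Extension χ u w₀
      close {w} {ws} {w′} {c} {d} f uc wd uw′ w′∈ =
        extension-trans (same-coloured same) conclude
        where
        open Origin (origin u w₀ uw₀ f w′∈ uw′)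

        c≢d : c ≢ d
        c≢d refl = uc w′ uw′

        open KempeChange (kempe n ⊤ (∣p∣≤n ⊤) c d c≢d χ P (λ v v∉ → contradiction ∈⊤ v∉) w wd)

        v≢w : v ≢ w
        v≢w v≡w = last∉ u w₀ f (subst (_∈ᴸ ws) v≡w v∈)

        u≢ : ∀ {x} → x ∈ᴸ w ∷ ws → u ≢ x
        u≢ x∈ refl = Adj-irrefl (fan-adjacent u w₀ P u~w₀ f x∈)

        ≢c : ∀ {a b γ} → χ a b ≡ just γ → Missing χ c a → γ ≢ c
        ≢c ab ac refl = ac _ ab

        -- No step up to `v` has colour `c`, which is missing at `u`, or colour `d`, which at `u`
        -- occurs only on the edge to `w′`; so the exchange leaves these steps intact.
        fan-v : Fan u w₀ ρ v vs
        fan-v = transfer u w₀ fan λ s →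
          let ub = step-colour u w₀ fan s
              γ≢c = ≢c ub uc
              γ≢d = λ { refl → w′∉ (subst (_∈ᴸ v ∷ vs) (χ-inj P ub uw′) (step-target u w₀ fan s)) }
          in same-missing same γ≢c γ≢d (step-missing u w₀ fan s) , same-colour same γ≢c γ≢d ub

        -- The only step of colour `d` leads from `v` to `w′`. If the path does not end at `u` or
        -- `v`, then `d` stays missing at `v`, and `u w′` keeps its colour because `c` stays missing
        -- at `u`.
        fan-w : v ≢ e → u ≢ e → Fan u w₀ ρ w ws
        fan-w v≢e u≢e = transfer u w₀ f transferred
          where
          transferred : ∀ {a b γ} → Step u w₀ f a b γ → Missing ρ γ a × ρ u b ≡ just γ
          transferred {a} {b} {γ} s with γ ≟ d
          ... | no γ≢d = same-missing same γ≢c γ≢d (step-missing u w₀ f s) ,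
                         same-colour same γ≢c γ≢d (step-colour u w₀ f s)
            where
            γ≢c : γ ≢ c
            γ≢c = ≢c (step-colour u w₀ f s) uc
          ... | yes refl =
            subst (Missing ρ d) (sym (unique s (χ-inj P (step-colour u w₀ f s) uw′)))
              (proj₂ (kept v v≢w v≢e) v-misses) ,
            same-β same (proj₁ (kept u (u≢ (here refl)) u≢e) uc) (step-colour u w₀ f s)

        -- The common missing colour is `d` at `u` and `v` if the path ends at `u`, `c` at `u` and
        -- `v` if it ends at `v`, and `c` at `u` and `w` otherwise.
        conclude : Extension ρ u w₀
        conclude with u ≟ e | v ≟ e
        ... | yes u≡e | _ = shift u w₀ ρ-proper u~w₀ fan-v
          (proj₁ (subst (Swapped c d χ ρ) (sym u≡e) swapped-e) uc)
          (proj₂ (kept v v≢w (λ v≡e → u≢ (there v∈) (trans u≡e (sym v≡e)))) v-misses)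
        ... | no u≢e | yes v≡e = shift u w₀ ρ-proper u~w₀ fan-v
          (proj₁ (kept u (u≢ (here refl)) u≢e) uc)
          (proj₂ (subst (Swapped c d χ ρ) (sym v≡e) swapped-e) v-misses)
        ... | no u≢e | no v≢e = shift u w₀ ρ-proper u~w₀ (fan-w v≢e u≢e)
          (proj₁ (kept u (u≢ (here refl)) u≢e) uc)
          (proj₂ swapped-x wd)

      -- `X` contains all vertices outside the fan and shrinks with each new one. A colour `d`
      -- missing at the last vertex is either missing at `u`, and the fan is shifted, or it is the
      -- colour of some `u w′`, and `w′` closes or prolongs the fan.
      grow : ∀ t (X : Subset n) → ∣ X ∣ ≤ t → ∀ {w ws} → (∀ x → x ∈ X ⊎ x ∈ᴸ w ∷ ws) →
        Fan u w₀ χ w ws → Extension χ u w₀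
      grow t X ∣X∣≤t {w} {ws} cover f with free P w
      ... | d , wd with missing? χ d u
      ...   | inj₁ ud = shift u w₀ P u~w₀ f ud wd
      ...   | inj₂ (w′ , uw′) with w′ ∈ᴸ? (w ∷ ws)
      ...     | yes w′∈ = close f (proj₂ (free P u)) wd uw′ w′∈
      ...     | no  w′∉ with cover w′
      ...       | inj₂ w′∈ = contradiction w′∈ w′∉
      grow zero X ∣X∣≤t cover f | d , wd | inj₂ (w′ , uw′) | no w′∉ | inj₁ w′∈X
        with () ← <-≤-trans (x∈p⇒∣p-x∣<∣p∣ w′∈X) ∣X∣≤t
      grow (suc t) X ∣X∣≤t {w} {ws} cover f | d , wd | inj₂ (w′ , uw′) | no w′∉ | inj₁ w′∈X =
        grow t (X - w′) (s≤s⁻¹ (<-≤-trans (x∈p⇒∣p-x∣<∣p∣ w′∈X) ∣X∣≤t)) cover′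
          (step f wd uw′ w′∉)
        where
        cover′ : ∀ x → x ∈ X - w′ ⊎ x ∈ᴸ w′ ∷ w ∷ ws
        cover′ x with x ≟ w′ | cover x
        ... | yes x≡w′ | _        = inj₂ (here x≡w′)
        ... | no  _    | inj₂ x∈  = inj₂ (there x∈)
        ... | no  x≢w′ | inj₁ x∈X = inj₁ (x∈p∧x≢y⇒x∈p-y x∈X x≢w′)

    extend : ∀ {χ} → Proper χ → ∀ {u v} → Adj u v → Extension χ u v
    extend {χ} P {u} {v} u~v with χ u v in uv
    ... | just c  = record { ρ = χ ; ρ-proper = P ; extends = id ; coloured = c , uv }
    ... | nothing = grow P u~v uv n ⊤ (∣p∣≤n ⊤) (λ _ → inj₁ ∈⊤) start

    colourPairs : (ps : List (Fin n × Fin n)) →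
      ∃ λ χ → Proper χ × (∀ {u v} → (u , v) ∈ᴸ ps → Adj u v → Coloured χ u v)
    colourPairs [] =
      (λ _ _ → nothing) ,
      record { χ-sym = λ _ _ → refl ; χ-inj = λ () ; χ-support = λ () } , λ ()
    colourPairs ((u , v) ∷ ps) with colourPairs ps | Adj? u v
    ... | χ , P , col | no ¬u~v = χ , P , λ
      { (here refl) u~v → contradiction u~v ¬u~v ; (there p) → col p }
    ... | χ , P , col | yes u~v = ρ , ρ-proper , λ
      { (here refl) _ → coloured ; (there p) a → extends (col p a) }
      where open Extension (extend P u~v)

-- Vizing's theorem for a given bound on the degrees.

record IsEdgeColouring {n : ℕ} (G : Graph n) {k : ℕ} (edge : Fin n → Fin n → Fin k) : Set where
  open Graph G
  field
    edge-sym  : ∀ u v → Adj u v → edge u v ≡ edge v u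
    edge-edge : ∀ u v w → Adj u v → Adj u w → v ≢ w → edge u v ≢ edge u w

vizing : ∀ {n} (G : Graph n) d → (∀ v → degree G v ≤ d) →
  ∃ λ (edge : Fin n → Fin n → Fin (suc d)) → IsEdgeColouring G edge
vizing {n} G d deg≤d = edge , record
  { edge-sym  = λ u v _ → cong (fromMaybe zero) (χ-sym u v)
  ; edge-edge = λ u v w u~v u~w v≢w eq →
      v≢w (χ-inj (proj₂ (coloured u~v)) (trans (proj₂ (coloured u~w))
        (cong just (trans (sym (edge-colour u~w)) (trans (sym eq) (edge-colour u~v)))))) }
  where
  open Graph G
  open EdgeColouring G (suc d)

  -- Pigeonhole: if all `suc d` colours occurred at `v`, they would inject into its at most `d`
  -- neighbours.
  free : ∀ {χ} → Proper χ → ∀ v → ∃ λ c → Missing χ c v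
  free {χ} P v with any? (λ c → all? (λ w → ¬? (≡-dec _≟_ (χ v w) (just c))))
  ... | yes p = p
  ... | no ¬p = contradiction tooMany 1+n≰n
    where
    present : ∀ c → ∃ λ w → χ v w ≡ just c
    present c with missing? χ c v
    ... | inj₁ m = contradiction (c , m) ¬p
    ... | inj₂ p = p

    tooMany : suc d ≤ d
    tooMany = begin
      suc d                  ≡⟨ ∣⊤∣≡n (suc d) ⟨
      ∣ ⊤ {suc d} ∣          ≤⟨ injective⇒∣p∣≤∣q∣ ⊤ (neighbours G v) (proj₁ ∘ present)
                                  (λ {c} _ → ∈-comprehension⁺ (Adj? v)
                                    (Proper.χ-support P (proj₂ (present c))))
                                  (λ {c} {c′} _ _ eq → just-injective
                                    (trans (sym (proj₂ (present c)))
                                      (trans (cong (χ v) eq) (proj₂ (present c′))))) ⟩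
      ∣ neighbours G v ∣     ≡⟨ degree≡∣neighbours∣ G v ⟨
      degree G v             ≤⟨ deg≤d v ⟩
      d                      ∎
      where open ≤-Reasoning

  pairs : List (Fin n × Fin n)
  pairs = cartesianProduct (allFin n) (allFin n)

  χ : PartialColouring
  χ = proj₁ (colourPairs free pairs)

  open Proper (proj₁ (proj₂ (colourPairs free pairs)))

  coloured : ∀ {u v} → Adj u v → Coloured χ u v
  coloured {u} {v} = proj₂ (proj₂ (colourPairs free pairs))
    (∈-cartesianProduct⁺ (∈-allFin u) (∈-allFin v))

  -- The default `zero` is taken only at uncoloured pairs, hence never at an edge.
  edge : Fin n → Fin n → Fin (suc d)
  edge u v = fromMaybe zero (χ u v)

  edge-colour : ∀ {u v} (a : Adj u v) → edge u v ≡ proj₁ (coloured a)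
  edge-colour a = cong (fromMaybe zero) (proj₂ (coloured a))

-- Arithmetic in ℤₙ for even n = 2h

module CyclicGroup (n : ℕ) .{{_ : NonZero n}} where
  open ℤₙ n

  abelianGroup : AbelianGroup 0ℓ 0ℓ
  abelianGroup = record { isAbelianGroup = record { isGroup = isGroup ; comm = ⊕-comm } }

  open AbelianGroup abelianGroup public
    using (group; commutativeSemigroup) renaming (identityʳ to ⊕-identityʳ; inverseʳ to ⊕-inverseʳ)
  open GroupProperties group public
    using () renaming (∙-cancelˡ to ⊕-cancelˡ; ∙-cancelʳ to ⊕-cancelʳ; ⁻¹-involutive to ⊖-involutive;
      ⁻¹-injective to ⊖-injective; inverseˡ-unique to ⊖-unique)
  open AbelianGroupProperties abelianGroup public using () renaming (⁻¹-∙-comm to ⊖-⊕-comm)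
  open CommutativeSemigroupProperties commutativeSemigroup public
    using () renaming (interchange to ⊕-interchange)

  infixl 6 _⊝_
  _⊝_ : Fin n → Fin n → Fin n
  v ⊝ u = (⊖ u) ⊕ v

  ⊝-⊕ : ∀ u s → (u ⊕ s) ⊝ u ≡ s
  ⊝-⊕ u s = trans (sym (⊕-assoc (⊖ u) u s)) (trans (cong (_⊕ s) (⊕-inverseˡ u)) (⊕-identityˡ s))

  ⊕-⊝ : ∀ u v → u ⊕ (v ⊝ u) ≡ v
  ⊕-⊝ u v = trans (sym (⊕-assoc u (⊖ u) v)) (trans (cong (_⊕ v) (⊕-inverseʳ u)) (⊕-identityˡ v))

  ⊖-⊝ : ∀ u v → ⊖ (v ⊝ u) ≡ u ⊝ v
  ⊖-⊝ u v = trans (sym (⊖-⊕-comm (⊖ u) v))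
                  (trans (cong (_⊕ (⊖ v)) (⊖-involutive u)) (⊕-comm u (⊖ v)))

  fixed⇒𝟎 : ∀ u s → u ⊕ s ≡ u → s ≡ 𝟎
  fixed⇒𝟎 u s eq = ⊕-cancelˡ u s 𝟎 (trans eq (sym (⊕-identityʳ u)))

  toℕ-⊕ : ∀ x y → toℕ (x ⊕ y) ≡ (toℕ x + toℕ y) % n
  toℕ-⊕ x y = toℕ-mod (toℕ x + toℕ y)

  -- For odd `n` equal to 2q + 1, multiplication by q + 1 undoes doubling.
  double-injective : ∀ q → n ≡ suc (q + q) → ∀ x y → x ⊕ x ≡ y ⊕ y → x ≡ y
  double-injective q n≡ x y eq = toℕ-injective (trans (sym (halve x))
    (trans (cong (λ c → (suc q % n * c) % n) toℕ-eq) (halve y)))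
    where
    toℕ-eq : (toℕ x + toℕ x) % n ≡ (toℕ y + toℕ y) % n
    toℕ-eq = trans (sym (toℕ-⊕ x x)) (trans (cong toℕ eq) (toℕ-⊕ y y))

    expand : ∀ q t → suc q * (t + t) ≡ t + t * suc (q + q)
    expand = solve-∀

    halve : ∀ z → (suc q % n * ((toℕ z + toℕ z) % n)) % n ≡ toℕ z
    halve z = begin
      (suc q % n * ((toℕ z + toℕ z) % n)) % n  ≡⟨ %-distribˡ-* (suc q) (toℕ z + toℕ z) n ⟨
      (suc q * (toℕ z + toℕ z)) % n            ≡⟨ cong (_% n) (expand q (toℕ z)) ⟩
      (toℕ z + toℕ z * suc (q + q)) % n        ≡⟨ cong (λ c → (toℕ z + toℕ z * c) % n) n≡ ⟨
      (toℕ z + toℕ z * n) % n                  ≡⟨ [m+kn]%n≡m%n (toℕ z) (toℕ z) n ⟩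
      toℕ z % n                                ≡⟨ m<n⇒m%n≡m (toℕ<n z) ⟩
      toℕ z                                    ∎
      where open ≡-Reasoning

module EvenCyclicGroup (n : ℕ) .{{_ : NonZero n}} (2∣n : 2 ∣ n) (h : ℕ) (n/2≡h : n / 2 ≡ h) where
  open ℤₙ n
  open CyclicGroup n

  h+h≡n : h + h ≡ n
  h+h≡n = trans (expand h) (trans (cong (_* 2) (sym n/2≡h)) (m/n*n≡m 2∣n))
    where
    expand : ∀ a → a + a ≡ a * 2
    expand = solve-∀

  h>0 : h > 0
  h>0 = n≢0⇒n>0 λ { refl → <⇒≢ (>-nonZero⁻¹ n) h+h≡n }

  instance
    h-nonZero : NonZero h
    h-nonZero = >-nonZero h>0

  toℕ-half : toℕ half ≡ h
  toℕ-half = trans (toℕ-fromℕ< _) n/2≡h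

  half≢𝟎 : half ≢ 𝟎
  half≢𝟎 eq = <⇒≢ h>0 (sym (trans (sym toℕ-half) (trans (cong toℕ eq)
    (trans (toℕ-mod 0) (m<n⇒m%n≡m (>-nonZero⁻¹ n))))))

  half⊕half≡𝟎 : half ⊕ half ≡ 𝟎
  half⊕half≡𝟎 = mod-≡ (trans
    (cong (_% n) (trans (cong₂ _+_ toℕ-half toℕ-half) h+h≡n))
    (trans (n%n≡0 n) (sym (m<n⇒m%n≡m (>-nonZero⁻¹ n)))))

  ⊖half≡half : ⊖ half ≡ half
  ⊖half≡half = sym (⊖-unique half half half⊕half≡𝟎)

  ⊕half-involutive : ∀ x → (x ⊕ half) ⊕ half ≡ x
  ⊕half-involutive x =
    trans (⊕-assoc x half half) (trans (cong (x ⊕_) half⊕half≡𝟎) (⊕-identityʳ x))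

  ⊕half-transpose : ∀ {x y} → x ⊕ half ≡ y → x ≡ y ⊕ half
  ⊕half-transpose {x} refl = sym (⊕half-involutive x)

  ⊖-⊕half : ∀ x → ⊖ (x ⊕ half) ≡ (⊖ x) ⊕ half
  ⊖-⊕half x = trans (sym (⊖-⊕-comm x half)) (cong ((⊖ x) ⊕_) ⊖half≡half)

  ⊖⊕half⇒⊕≡half : ∀ {x} y → x ≡ ⊖ (y ⊕ half) → x ⊕ y ≡ half
  ⊖⊕half⇒⊕≡half y refl = begin
    (⊖ (y ⊕ half)) ⊕ y    ≡⟨ cong (_⊕ y) (trans (⊖-⊕half y) (⊕-comm (⊖ y) half)) ⟩
    (half ⊕ (⊖ y)) ⊕ y    ≡⟨ ⊕-assoc half (⊖ y) y ⟩
    half ⊕ ((⊖ y) ⊕ y)    ≡⟨ cong (half ⊕_) (⊕-inverseˡ y) ⟩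
    half ⊕ 𝟎              ≡⟨ ⊕-identityʳ half ⟩
    half                  ∎
    where open ≡-Reasoning

  -- The quotient by the subgroup {0, half}.

  infix 4 _≈_
  -- Congruence modulo `h`: lying in the same coset of {0, half}.
  _≈_ : Fin n → Fin n → Set
  x ≈ y = x ≡ y ⊎ x ≡ y ⊕ half

  ≈-cancelˡ : ∀ u s t → u ⊕ s ≈ u ⊕ t → s ≈ t
  ≈-cancelˡ u s t (inj₁ eq) = inj₁ (⊕-cancelˡ u s t eq)
  ≈-cancelˡ u s t (inj₂ eq) = inj₂ (⊕-cancelˡ u s (t ⊕ half) (trans eq (⊕-assoc u t half)))

  residue : Fin n → ℕ
  residue x = toℕ x % h

  residue<h : ∀ x → residue x < h
  residue<h x = m%n<n (toℕ x) h

  residue-split : ∀ x → toℕ x ≡ residue x ⊎ toℕ x ≡ residue x + h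
  residue-split x with toℕ x / h | m≡m%n+[m/n]*n (toℕ x) h
  ... | 0           | eq = inj₁ (trans eq (+-identityʳ _))
  ... | 1           | eq = inj₂ (trans eq (cong (residue x +_) (*-identityˡ h)))
  ... | suc (suc k) | eq = contradiction (toℕ<n x) (≤⇒≯ (begin
    n                              ≡⟨ h+h≡n ⟨
    h + h                          ≤⟨ +-monoʳ-≤ h (m≤m+n h (k * h)) ⟩
    suc (suc k) * h                ≤⟨ m≤n+m _ (residue x) ⟩
    residue x + suc (suc k) * h    ≡⟨ eq ⟨
    toℕ x                          ∎))
    where open ≤-Reasoning

  toℕ≡+h⇒≡⊕half : ∀ {x y} → toℕ x ≡ toℕ y + h → x ≡ y ⊕ half
  toℕ≡+h⇒≡⊕half {x} {y} eq = toℕ-injective (begin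
    toℕ x                   ≡⟨ m<n⇒m%n≡m (toℕ<n x) ⟨
    toℕ x % n               ≡⟨ cong (_% n) (trans eq (cong (toℕ y +_) (sym toℕ-half))) ⟩
    (toℕ y + toℕ half) % n  ≡⟨ toℕ-⊕ y half ⟨
    toℕ (y ⊕ half)          ∎)
    where open ≡-Reasoning

  residue-injective : ∀ x y → residue x ≡ residue y → x ≈ y
  residue-injective x y eq with residue-split x | residue-split y
  ... | inj₁ p | inj₁ q = inj₁ (toℕ-injective (trans p (trans eq (sym q))))
  ... | inj₂ p | inj₂ q = inj₁ (toℕ-injective (trans p (trans (cong (_+ h) eq) (sym q))))
  ... | inj₂ p | inj₁ q = inj₂ (toℕ≡+h⇒≡⊕half (trans p (cong (_+ h) (trans eq (sym q)))))
  ... | inj₁ p | inj₂ q = inj₂ (⊕half-transpose (sym (toℕ≡+h⇒≡⊕half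
                            (trans q (cong (_+ h) (trans (sym eq) (sym p)))))))

  -- Adding `h` to `x` changes its double by h + h, which is `n`.
  residue-double : ∀ x → toℕ (x ⊕ x) ≡ (residue x + residue x) % n
  residue-double x = trans (toℕ-⊕ x x) (reduce (residue-split x))
    where
    expand : ∀ a b → a + b + (a + b) ≡ a + a + 1 * (b + b)
    expand = solve-∀
    reduce : toℕ x ≡ residue x ⊎ toℕ x ≡ residue x + h →
             (toℕ x + toℕ x) % n ≡ (residue x + residue x) % n
    reduce (inj₁ eq) = cong (λ c → (c + c) % n) eq
    reduce (inj₂ eq) = begin
      (toℕ x + toℕ x) % n                        ≡⟨ cong (λ c → (c + c) % n) eq ⟩
      (residue x + h + (residue x + h)) % n      ≡⟨ cong (_% n) (expand (residue x) h) ⟩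
      (residue x + residue x + 1 * (h + h)) % n  ≡⟨ cong (λ c → (residue x + residue x + 1 * c) % n) h+h≡n ⟩
      (residue x + residue x + 1 * n) % n        ≡⟨ [m+kn]%n≡m%n (residue x + residue x) 1 n ⟩
      (residue x + residue x) % n                ∎
      where open ≡-Reasoning

  -- Here `q` is a quarter of `n`, so a shift of the residue by `q` doubles to a shift by `half`.
  residue-half-shift : ∀ q → q + q ≡ h → ∀ x y → residue x + q ≡ residue y →
    y ⊕ y ≡ (x ⊕ x) ⊕ half
  residue-half-shift q q+q≡h x y eq = toℕ-injective (begin
    toℕ (y ⊕ y)                              ≡⟨ residue-double y ⟩
    (residue y + residue y) % n              ≡⟨ cong (λ c → (c + c) % n) eq ⟨
    (residue x + q + (residue x + q)) % n    ≡⟨ cong (_% n) (expand (residue x) q) ⟩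
    (residue x + residue x + (q + q)) % n    ≡⟨ cong (λ c → (residue x + residue x + c) % n) q+q≡h ⟩
    (residue x + residue x + h) % n          ≡⟨ %-distribˡ-+ (residue x + residue x) h n ⟩
    ((residue x + residue x) % n + h % n) % n
      ≡⟨ cong₂ (λ c d → (c + d) % n) (sym (residue-double x))
           (trans (cong (_% n) (sym toℕ-half)) (m<n⇒m%n≡m (toℕ<n half))) ⟩
    (toℕ (x ⊕ x) + toℕ half) % n             ≡⟨ toℕ-⊕ (x ⊕ x) half ⟨
    toℕ ((x ⊕ x) ⊕ half)                     ∎)
    where
    open ≡-Reasoning
    expand : ∀ a b → a + b + (a + b) ≡ a + a + (b + b)
    expand = solve-∀

  -- What is excluded is that twice x - y equals `half`; for even `h` these are the pairs whose
  -- residues are matched as a and a + h/2.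
  Compatible : Fin n → Fin n → Set
  Compatible x y = x ⊕ x ≢ (y ⊕ y) ⊕ half

  compatible-refl : ∀ x → Compatible x x
  compatible-refl x eq = half≢𝟎 (fixed⇒𝟎 (x ⊕ x) half (sym eq))

  -- Cancelling `u ⊕ u` in the forbidden equation leaves `(s ⊕ s) ⊕ half` equal to 0, and `half` is
  -- its own inverse.
  compatible-⊕ : ∀ u {s} → s ⊕ s ≢ half → Compatible u (u ⊕ s)
  compatible-⊕ u {s} s⊕s≢half eq = s⊕s≢half (trans
    (⊕half-transpose (fixed⇒𝟎 (u ⊕ u) ((s ⊕ s) ⊕ half) (sym (begin
      u ⊕ u                          ≡⟨ eq ⟩
      ((u ⊕ s) ⊕ (u ⊕ s)) ⊕ half     ≡⟨ cong (_⊕ half) (⊕-interchange u s u s) ⟩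
      ((u ⊕ u) ⊕ (s ⊕ s)) ⊕ half     ≡⟨ ⊕-assoc (u ⊕ u) (s ⊕ s) half ⟩
      (u ⊕ u) ⊕ ((s ⊕ s) ⊕ half)     ∎))))
    (⊕-identityˡ half))
    where open ≡-Reasoning

  opposite⇒incompatible : ∀ q → q + q ≡ h → ∀ x y →
    residue x + q ≡ residue y ⊎ residue y + q ≡ residue x → ¬ Compatible x y
  opposite⇒incompatible q 2q≡h x y (inj₁ p) compatible =
    compatible (⊕half-transpose (sym (residue-half-shift q 2q≡h x y p)))
  opposite⇒incompatible q 2q≡h x y (inj₂ p) compatible =
    compatible (residue-half-shift q 2q≡h y x p)

-- A bijection of {0, …, 2q - 1} with the nonzero residues modulo 2q + 1 under which
-- a and a + q become opposite.
fold : ℕ → ℕ → ℕ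
fold q a with a <? q
... | yes _ = suc a
... | no  _ = q + q ∸ (a ∸ q)

module _ (q : ℕ) where

  -- Describes the second half without subtraction: q + i goes to 2q - i, the opposite of i + 1
  -- modulo 2q + 1.
  fold-cases : ∀ {a} → a < q + q →
    (a < q × fold q a ≡ suc a) ⊎ (∃ λ i → i < q × q + i ≡ a × fold q a + i ≡ q + q)
  fold-cases {a} a<2q with a <? q
  ... | yes a<q = inj₁ (a<q , refl)
  ... | no  a≮q = inj₂ (a ∸ q , i<q , q+i≡a , m∸n+n≡m (≤-trans (<⇒≤ i<q) (m≤m+n q q)))
    where
    q+i≡a : q + (a ∸ q) ≡ a
    q+i≡a = m+[n∸m]≡n (≮⇒≥ a≮q)
    i<q : a ∸ q < q
    i<q = +-cancelˡ-< q _ _ (subst (_< q + q) (sym q+i≡a) a<2q)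

  private
    -- Keeps the two halves apart: a common value a + 1 = 2q - i would give a + 1 + i = 2q.
    suc+<⇒≢2q : ∀ {a i} → a < q → i < q → suc a + i ≢ q + q
    suc+<⇒≢2q a<q i<q = <⇒≢ (+-mono-≤-< a<q i<q)

  fold-bounds : ∀ {a} → a < q + q → 0 < fold q a × fold q a ≤ q + q
  fold-bounds a<2q with fold-cases a<2q
  ... | inj₁ (a<q , eq) rewrite eq = s≤s z≤n , ≤-trans a<q (m≤m+n q q)
  ... | inj₂ (i , i<q , _ , eq) = positive (fold q _) eq , m+n≤o⇒m≤o _ (≤-reflexive eq)
    where
    positive : ∀ m → m + i ≡ q + q → 0 < m
    positive (suc m) eq = s≤s z≤n
    positive zero    eq = contradiction eq (<⇒≢ (≤-trans i<q (m≤m+n q q)))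

  fold-injective : ∀ {a b} → a < q + q → b < q + q → fold q a ≡ fold q b → a ≡ b
  fold-injective a< b< eq with fold-cases a< | fold-cases b<
  ... | inj₁ (a<q , fa) | inj₁ (b<q , fb) = cong pred (trans (sym fa) (trans eq fb))
  ... | inj₁ (a<q , fa) | inj₂ (j , j<q , _ , fb) =
    contradiction (trans (cong (_+ j) (trans (sym fa) eq)) fb) (suc+<⇒≢2q a<q j<q)
  ... | inj₂ (i , i<q , _ , fa) | inj₁ (b<q , fb) =
    contradiction (trans (cong (_+ i) (trans (sym fb) (sym eq))) fa) (suc+<⇒≢2q b<q i<q)
  ... | inj₂ (i , _ , refl , fa) | inj₂ (j , _ , refl , fb) =
    cong (q +_) (+-cancelˡ-≡ (fold q (q + i)) i j (trans fa (sym (trans (cong (_+ j) eq) fb))))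

  -- Two values from the first half add up to at most 2q, two from the second to at least 2q + 2. So
  -- there is one of each kind, and (a + 1) + (2q - j) = 2q + 1 gives a = j.
  fold-opposite : ∀ {a b} → a < q + q → b < q + q → fold q a + fold q b ≡ suc (q + q) →
    a + q ≡ b ⊎ b + q ≡ a
  fold-opposite {a} {b} a< b< eq with fold-cases a< | fold-cases b<
  ... | inj₁ (a<q , fa) | inj₁ (b<q , fb) =
    contradiction (cong pred (trans (cong₂ _+_ (sym fa) (sym fb)) eq))
      (<⇒≢ (+-mono-<-≤ a<q b<q))
  ... | inj₁ (a<q , fa) | inj₂ (j , j<q , refl , fb) =
    inj₁ (trans (+-comm a q) (cong (q +_) (+-cancelˡ-≡ (fold q (q + j)) a j
      (trans (+-comm (fold q (q + j)) a) (trans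
        (cong pred (trans (cong (_+ fold q (q + j)) (sym fa)) eq)) (sym fb))))))
  ... | inj₂ (i , i<q , refl , fa) | inj₁ (b<q , fb) =
    inj₂ (trans (+-comm b q) (cong (q +_) (+-cancelˡ-≡ (fold q (q + i)) b i
      (trans (cong pred (trans (sym (+-suc (fold q (q + i)) b))
        (trans (cong (fold q (q + i) +_) (sym fb)) eq))) (sym fa)))))
  ... | inj₂ (i , i<q , refl , fa) | inj₂ (j , j<q , refl , fb) =
    contradiction (+-cancelˡ-≡ (q + q) (suc i + j) (q + q) (begin
      q + q + (suc i + j)                          ≡⟨ shuffle₁ (q + q) i j ⟩
      suc (q + q) + (i + j)                        ≡⟨ cong (_+ (i + j)) eq ⟨
      fold q (q + i) + fold q (q + j) + (i + j)    ≡⟨ shuffle₂ (fold q (q + i)) (fold q (q + j)) i j ⟩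
      (fold q (q + i) + i) + (fold q (q + j) + j)  ≡⟨ cong₂ _+_ fa fb ⟩
      q + q + (q + q)                              ∎)) (suc+<⇒≢2q i<q j<q)
    where
    open ≡-Reasoning
    shuffle₁ : ∀ m i j → m + (suc i + j) ≡ suc m + (i + j)
    shuffle₁ = solve-∀
    shuffle₂ : ∀ x y i j → x + y + (i + j) ≡ (x + i) + (y + j)
    shuffle₂ = solve-∀

even⊎odd : ∀ m → (∃ λ q → q + q ≡ m) ⊎ (∃ λ q → suc (q + q) ≡ m)
even⊎odd zero    = inj₁ (0 , refl)
even⊎odd (suc m) with even⊎odd m
... | inj₁ (q , refl) = inj₂ (q , refl)
... | inj₂ (q , refl) = inj₁ (suc q , cong suc (+-suc q q))

-- Colouring vertices and edges through their classes modulo `h`.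

module Schemes (n : ℕ) .{{_ : NonZero n}} (2∣n : 2 ∣ n) (h : ℕ) (n/2≡h : n / 2 ≡ h) where
  open ℤₙ n
  open CyclicGroup n
  open EvenCyclicGroup n 2∣n h n/2≡h

  -- κ x x will be the colour of the vertex x, and κ x y that of an edge x y.
  record Scheme (c : ℕ) : Set where
    field
      κ       : Fin n → Fin n → Fin c
      κ-sym   : ∀ x y → κ x y ≡ κ y x
      κ-diag  : ∀ x y → κ x x ≡ κ y y → x ≈ y
      κ-latin : ∀ x y z → Compatible x y → Compatible x z → κ x y ≡ κ x z → y ≈ z

  -- The addition table modulo `h`: cancellation makes it Latin, and its diagonal has distinct
  -- entries because doubling is injective for odd `h`.
  oddScheme : ∀ q → suc (q + q) ≡ h → Scheme h
  oddScheme q 1+2q≡h = record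
    { κ = λ x y → φ x ⊕′ φ y
    ; κ-sym = λ x y → ⊕′-comm (φ x) (φ y)
    ; κ-diag = λ x y eq → φ-injective x y (double-injective′ q (sym 1+2q≡h) (φ x) (φ y) eq)
    ; κ-latin = λ x y z _ _ eq → φ-injective y z (cancel (φ x) (φ y) (φ z) eq)
    }
    where
    open ℤₙ h using () renaming (_⊕_ to _⊕′_; ⊕-comm to ⊕′-comm; toℕ-mod to toℕ-mod-h)
    open CyclicGroup h using () renaming (double-injective to double-injective′; ⊕-cancelˡ to cancel)

    φ : Fin n → Fin h
    φ x = toℕ x mod h

    φ-injective : ∀ x y → φ x ≡ φ y → x ≈ y
    φ-injective x y eq = residue-injective x y
      (trans (sym (toℕ-mod-h (toℕ x))) (trans (cong toℕ eq) (toℕ-mod-h (toℕ y))))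

  -- 0 is never the sum of compatible elements, so it is dropped from the h + 1 colours.
  evenScheme : ∀ q → q + q ≡ h → Scheme h
  evenScheme q 2q≡h = record
    { κ = λ x y → drop (φ x ⊕′ φ y)
    ; κ-sym = λ x y → cong drop (⊕′-comm (φ x) (φ y))
    ; κ-diag = λ x y eq → φ-injective x y (double-injective′ q (cong suc (sym 2q≡h)) (φ x) (φ y)
        (drop-injective (nonzero x x (compatible-refl x)) (nonzero y y (compatible-refl y)) eq))
    ; κ-latin = λ x y z xy xz eq → φ-injective y z (cancel (φ x) (φ y) (φ z)
        (drop-injective (nonzero x y xy) (nonzero x z xz) eq))
    }
    where
    open ℤₙ (suc h) using () renaming (_⊕_ to _⊕′_; ⊕-comm to ⊕′-comm)
    open CyclicGroup (suc h) using ()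
      renaming (double-injective to double-injective′; ⊕-cancelˡ to cancel; toℕ-⊕ to toℕ-⊕′)

    drop : Fin (suc h) → Fin h
    -- A default value, never reached from the sum of compatible elements.
    drop zero    = fromℕ< h>0
    drop (suc i) = i

    drop-injective : ∀ {i j} → i ≢ zero → j ≢ zero → drop i ≡ drop j → i ≡ j
    drop-injective {zero}          i≢0 j≢0 eq = contradiction refl i≢0
    drop-injective {suc i} {zero}  i≢0 j≢0 eq = contradiction refl j≢0
    drop-injective {suc i} {suc j} i≢0 j≢0 eq = cong suc eq

    bounded : ∀ x → residue x < q + q
    bounded x = subst (residue x <_) (sym 2q≡h) (residue<h x)

    fold≤h : ∀ x → fold q (residue x) ≤ h
    fold≤h x = subst (fold q (residue x) ≤_) 2q≡h (proj₂ (fold-bounds q (bounded x)))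

    φ : Fin n → Fin (suc h)
    φ x = fromℕ< (s≤s (fold≤h x))

    toℕ-φ : ∀ x → toℕ (φ x) ≡ fold q (residue x)
    toℕ-φ x = toℕ-fromℕ< (s≤s (fold≤h x))

    φ-injective : ∀ x y → φ x ≡ φ y → x ≈ y
    φ-injective x y eq = residue-injective x y (fold-injective q (bounded x) (bounded y)
      (trans (sym (toℕ-φ x)) (trans (cong toℕ eq) (toℕ-φ y))))

    -- The next multiple, 2(h + 1), already exceeds 2h.
    multiple : ∀ {s} → 0 < s → s ≤ h + h → suc h ∣ s → s ≡ suc h
    multiple s>0 s≤2h (divides 0 refl) = contradiction refl (<⇒≢ s>0)
    multiple s>0 s≤2h (divides 1 eq)   = trans eq (*-identityˡ (suc h))
    multiple s>0 s≤2h (divides (suc (suc k)) refl) = contradiction s≤2h (<⇒≱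
      (+-mono-<-≤ (n<1+n h) (≤-trans (n≤1+n h) (m≤m+n (suc h) (k * suc h)))))

    -- If the sum vanished, the two `fold` values would add up to exactly h + 1 = 2q + 1, so the
    -- residues would differ by `q`, against compatibility.
    nonzero : ∀ x y → Compatible x y → φ x ⊕′ φ y ≢ zero
    nonzero x y compatible eq =
      opposite⇒incompatible q 2q≡h x y
        (fold-opposite q (bounded x) (bounded y) (trans sum≡1+h (cong suc (sym 2q≡h))))
        compatible
      where
      sum : ℕ
      sum = fold q (residue x) + fold q (residue y)

      sum%≡0 : sum % suc h ≡ 0
      sum%≡0 = trans (cong₂ (λ a b → (a + b) % suc h) (sym (toℕ-φ x)) (sym (toℕ-φ y)))
                     (trans (sym (toℕ-⊕′ (φ x) (φ y))) (cong toℕ eq))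

      sum≡1+h : sum ≡ suc h
      sum≡1+h = multiple (≤-trans (proj₁ (fold-bounds q (bounded x))) (m≤m+n _ _))
        (+-mono-≤ (fold≤h x) (fold≤h y)) (m%n≡0⇒n∣m sum (suc h) sum%≡0)

  scheme : Scheme h
  scheme with even⊎odd h
  ... | inj₁ (q , eq) = evenScheme q eq
  ... | inj₂ (q , eq) = oddScheme q eq

-- The subset `D` and the total colouring of the circulant graph.

module Circulant (n : ℕ) .{{_ : NonZero n}} (2∣n : 2 ∣ n) (h : ℕ) (n/2≡h : n / 2 ≡ h)
  (S : Subset n) (S-cayley : IsCayleySet (ℤₙ.isGroup n) S) (half∉S : ℤₙ.half n ∉ S) where
  open ℤₙ n
  open CyclicGroup n
  open EvenCyclicGroup n 2∣n h n/2≡h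
  open IsCayleySet S-cayley
  open Schemes n 2∣n h n/2≡h
  open Scheme scheme

  -- The distance from `x` to 0 around the cycle, which determines `x` up to sign.
  weight : Fin n → ℕ
  weight x = toℕ x ⊓ toℕ (⊖ x)

  weight-⊖ : ∀ x → weight (⊖ x) ≡ weight x
  weight-⊖ x = trans (cong (λ y → toℕ (⊖ x) ⊓ toℕ y) (⊖-involutive x)) (⊓-comm (toℕ (⊖ x)) (toℕ x))

  weight-injective : ∀ x y → weight x ≡ weight y → x ≡ y ⊎ x ≡ ⊖ y
  weight-injective x y eq with ⊓-sel (toℕ x) (toℕ (⊖ x)) | ⊓-sel (toℕ y) (toℕ (⊖ y))
  ... | inj₁ p | inj₁ q = inj₁ (toℕ-injective (trans (sym p) (trans eq q)))
  ... | inj₁ p | inj₂ q = inj₂ (toℕ-injective (trans (sym p) (trans eq q)))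
  ... | inj₂ p | inj₁ q = inj₂ (trans (sym (⊖-involutive x))
                            (cong ⊖_ (toℕ-injective (trans (sym p) (trans eq q)))))
  ... | inj₂ p | inj₂ q = inj₁ (⊖-injective (toℕ-injective (trans (sym p) (trans eq q))))

  -- D contains at most one of x and x ⊕ half; when both lie in S, comparing weights makes the choice
  -- invariant under ⊖, and rejects x if x ⊕ x ≡ half.
  InD : Fin n → Set
  InD x = x ∈ S × (x ⊕ half ∉ S ⊎ weight x < weight (x ⊕ half))

  inD? : ∀ x → Dec (InD x)
  inD? x = (x ∈? S) ×-dec (¬? (x ⊕ half ∈? S) ⊎-dec (weight x <? weight (x ⊕ half)))

  D : Subset n
  D = comprehension inD?

  D⁺ : ∀ {x} → InD x → x ∈ D
  D⁺ = ∈-comprehension⁺ inD?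

  D⁻ : ∀ {x} → x ∈ D → InD x
  D⁻ = ∈-comprehension⁻ inD?

  D⊆S : D ⊆ S
  D⊆S x∈D = proj₁ (D⁻ x∈D)

  -- Negation preserves `S` and the weight, and it commutes with adding `half`.
  D-⊖ : ∀ {x} → x ∈ D → ⊖ x ∈ D
  D-⊖ {x} x∈D with D⁻ x∈D
  ... | x∈S , inj₁ out = D⁺ (symmetric x x∈S , inj₁ λ ⊖x+half∈S → out
          (subst (_∈ S) (trans (cong ⊖_ (sym (⊖-⊕half x))) (⊖-involutive (x ⊕ half)))
            (symmetric _ ⊖x+half∈S)))
  ... | x∈S , inj₂ lt = D⁺ (symmetric x x∈S , inj₂ (subst₂ _<_ (sym (weight-⊖ x))
          (trans (sym (weight-⊖ (x ⊕ half))) (cong weight (⊖-⊕half x))) lt))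

  D-⊕half : ∀ {x} → x ∈ D → x ⊕ half ∉ D
  D-⊕half {x} x∈D x+half∈D with proj₂ (D⁻ x∈D) | proj₂ (D⁻ x+half∈D)
  ... | inj₁ out | _        = out (D⊆S x+half∈D)
  ... | inj₂ _   | inj₁ out = out (subst (_∈ S) (sym (⊕half-involutive x)) (D⊆S x∈D))
  ... | inj₂ lt  | inj₂ gt  = <-asym lt (subst (λ y → weight (x ⊕ half) < weight y)
                                (⊕half-involutive x) gt)

  -- If twice `x` were `half`, then `⊖ x` would be `x ⊕ half`, and `D` would contain both elements
  -- of a coset.
  D-double : ∀ {x} → x ∈ D → x ⊕ x ≢ half
  D-double {x} x∈D x⊕x≡half = D-⊕half x∈D (subst (_∈ D) ⊖x≡x⊕half (D-⊖ x∈D))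
    where
    ⊖x≡x⊕half : ⊖ x ≡ x ⊕ half
    ⊖x≡x⊕half = sym (⊖-unique (x ⊕ half) x (begin
      (x ⊕ half) ⊕ x  ≡⟨ cong (_⊕ x) (⊕-comm x half) ⟩
      (half ⊕ x) ⊕ x  ≡⟨ ⊕-assoc half x x ⟩
      half ⊕ (x ⊕ x)  ≡⟨ cong (half ⊕_) x⊕x≡half ⟩
      half ⊕ half     ≡⟨ half⊕half≡𝟎 ⟩
      𝟎               ∎))
      where open ≡-Reasoning

  -- Only a tie of weights could keep both elements of the coset out of `D`. A tie means that `x` is
  -- `x ⊕ half`, which is impossible, or its negative, which makes `x ⊕ x` equal to `half`.
  ⊕half∈D : ∀ {x} → x ∈ S → x ∉ D → x ⊕ x ≢ half → x ⊕ half ∈ D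
  ⊕half∈D {x} x∈S x∉D x⊕x≢half with x ⊕ half ∈? S
  ... | no  out = contradiction (D⁺ (x∈S , inj₁ out)) x∉D
  ... | yes x+half∈S with <-cmp (weight x) (weight (x ⊕ half))
  ...   | tri< lt _ _ = contradiction (D⁺ (x∈S , inj₂ lt)) x∉D
  ...   | tri> _ _ gt = D⁺ (x+half∈S , inj₂ (subst (λ y → weight (x ⊕ half) < weight y)
                          (sym (⊕half-involutive x)) gt))
  ...   | tri≈ _ eq _ with weight-injective x (x ⊕ half) eq
  ...     | inj₁ p = contradiction (fixed⇒𝟎 x half (sym p)) half≢𝟎
  ...     | inj₂ p = contradiction (⊖⊕half⇒⊕≡half x p) x⊕x≢half

  ∣M∣≤∣D∣ : (M : Subset n) → M ⊆ S → (∀ x y → x ∈ M → y ∈ M → x ⊕ y ≢ half) → ∣ M ∣ ≤ ∣ D ∣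
  ∣M∣≤∣D∣ M M⊆S M-sums = injective⇒∣p∣≤∣q∣ M D f f∈D f-injective
    where
    f : Fin n → Fin n
    f x with x ∈? D
    ... | yes _ = x
    -- This is half - x. If it equals an unreplaced element of `M`, that element and `x` add up to
    -- `half`.
    ... | no  _ = ⊖ (x ⊕ half)

    f∈D : ∀ {x} → x ∈ M → f x ∈ D
    f∈D {x} x∈M with x ∈? D
    ... | yes x∈D = x∈D
    -- The condition on sums is applied to `x` taken twice.
    ... | no  x∉D = D-⊖ (⊕half∈D (M⊆S x∈M) x∉D (M-sums x x x∈M x∈M))

    f-injective : ∀ {x y} → x ∈ M → y ∈ M → f x ≡ f y → x ≡ y
    f-injective {x} {y} x∈M y∈M eq with x ∈? D | y ∈? D
    ... | yes _ | yes _ = eq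
    ... | yes _ | no  _ = contradiction (⊖⊕half⇒⊕≡half y eq) (M-sums x y x∈M y∈M)
    ... | no  _ | yes _ = contradiction (⊖⊕half⇒⊕≡half x (sym eq)) (M-sums y x y∈M x∈M)
    ... | no  _ | no  _ = ⊕-cancelʳ half x y (⊖-injective eq)

  R : Subset n
  R = S ─ D

  R⊆S : R ⊆ S
  R⊆S = p─q⊆p S D

  R-⊖ : ∀ {x} → x ∈ R → ⊖ x ∈ R
  R-⊖ {x} x∈R = x∈p∧x∉q⇒x∈p─q (symmetric x (R⊆S x∈R))
    (λ ⊖x∈D → x∈p─q⇒x∉q S D x∈R (subst (_∈ D) (⊖-involutive x) (D-⊖ ⊖x∈D)))

  G : Graph n
  G = circulant S S-cayley

  -- Built directly from the differences, since `Cay` asks for a generating set and `R` may fail to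
  -- generate.
  remainder : Graph n
  remainder = record
    { Adj        = λ u v → v ⊝ u ∈ R
    ; Adj?       = λ u v → v ⊝ u ∈? R
    ; Adj-sym    = λ {u} {v} uv → subst (_∈ R) (⊖-⊝ u v) (R-⊖ uv)
    ; Adj-irrefl = λ {v} vv → ε∉S (subst (_∈ S) (⊕-inverseˡ v) (R⊆S vv)) }

  degree-remainder : ∀ v → degree remainder v ≤ ∣ R ∣
  degree-remainder v = subst (_≤ ∣ R ∣) (sym (degree≡∣neighbours∣ remainder v))
    (injective⇒∣p∣≤∣q∣ (neighbours remainder v) R (_⊝ v)
      (∈-comprehension⁻ (Graph.Adj? remainder v)) (λ {x} {y} _ _ → ⊕-cancelˡ (⊖ v) x y))

  ∣S∣≤Δ : ∣ S ∣ ≤ Δ G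
  ∣S∣≤Δ = ≤-trans
    (injective⇒∣p∣≤∣q∣ S (neighbours G 𝟎) (𝟎 ⊕_)
      (λ {s} s∈S → ∈-comprehension⁺ (Graph.Adj? G 𝟎) (s , s∈S , refl))
      (λ {x} {y} _ _ → ⊕-cancelˡ 𝟎 x y))
    (subst (_≤ Δ G) (degree≡∣neighbours∣ G 𝟎) (degree≤Δ G 𝟎))

  Adj⇒∈S : ∀ {u v} → Graph.Adj G u v → v ⊝ u ∈ S
  Adj⇒∈S {u} (s , s∈S , refl) = subst (_∈ S) (sym (⊝-⊕ u s)) s∈S

  -- Congruent ends would differ by 0 or by `half`, and `S` contains neither.
  ∈S⇒≉ : ∀ {u v} → v ⊝ u ∈ S → ¬ (v ≈ u)
  ∈S⇒≉ {u} {v} s∈S (inj₁ refl) = ε∉S (subst (_∈ S) (⊕-inverseˡ u) s∈S)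
  ∈S⇒≉ {u} {v} s∈S (inj₂ refl) = half∉S (subst (_∈ S) (⊝-⊕ u half) s∈S)

  edgeᴿ : Fin n → Fin n → Fin (suc ∣ R ∣)
  edgeᴿ = proj₁ (vizing remainder ∣ R ∣ degree-remainder)

  open IsEdgeColouring (proj₂ (vizing remainder ∣ R ∣ degree-remainder))
    renaming (edge-sym to edgeᴿ-sym; edge-edge to edgeᴿ-edgeᴿ)

  -- The first `h` colours serve the vertices and the edges with difference in `D`; the others serve
  -- `remainder`.
  vertex : Fin n → Fin (h + suc ∣ R ∣)
  vertex u = κ u u ↑ˡ suc ∣ R ∣

  edge : Fin n → Fin n → Fin (h + suc ∣ R ∣)
  edge u v with v ⊝ u ∈? D
  ... | yes _ = κ u v ↑ˡ suc ∣ R ∣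
  ... | no  _ = h ↑ʳ edgeᴿ u v

  ↑ˡ≢↑ʳ : ∀ (i : Fin h) (j : Fin (suc ∣ R ∣)) → i ↑ˡ suc ∣ R ∣ ≢ h ↑ʳ j
  ↑ˡ≢↑ʳ i j eq with () ← trans (sym (splitAt-↑ˡ h i (suc ∣ R ∣)))
                           (trans (cong (splitAt h) eq) (splitAt-↑ʳ h (suc ∣ R ∣) j))

  compatible : ∀ u v → v ⊝ u ∈ D → Compatible u v
  compatible u v d∈D = subst (Compatible u) (⊕-⊝ u v) (compatible-⊕ u (D-double d∈D))

  inR : ∀ {u v} → Graph.Adj G u v → v ⊝ u ∉ D → v ⊝ u ∈ R
  inR uv ∉D = x∈p∧x∉q⇒x∈p─q (Adj⇒∈S uv) ∉D

  -- Turns the Latin property, which holds only up to `≈`, into a statement about distinct edges at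
  -- a vertex.
  D-≈ : ∀ {s t} → s ∈ D → t ∈ D → s ≈ t → s ≡ t
  D-≈ s∈D t∈D (inj₁ eq)   = eq
  D-≈ s∈D t∈D (inj₂ refl) = contradiction s∈D (D-⊕half t∈D)

  isTotalColouring : IsTotalColouring G vertex edge
  isTotalColouring = record
    { edge-sym = edge-sym ; vertex-vertex = vertex-vertex
    ; edge-edge = edge-edge ; vertex-edge = vertex-edge }
    where
    open Graph G using (Adj)

    edge-sym : ∀ u v → Adj u v → edge u v ≡ edge v u
    edge-sym u v uv with v ⊝ u ∈? D | u ⊝ v ∈? D
    ... | yes _  | yes _  = cong (_↑ˡ suc ∣ R ∣) (κ-sym u v)
    ... | no ∉D  | no _   = cong (h ↑ʳ_) (edgeᴿ-sym u v (inR uv ∉D))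
    ... | yes ∈D | no ∉D  = contradiction (subst (_∈ D) (⊖-⊝ u v) (D-⊖ ∈D)) ∉D
    ... | no ∉D  | yes ∈D = contradiction (subst (_∈ D) (⊖-⊝ v u) (D-⊖ ∈D)) ∉D

    vertex-vertex : ∀ u v → Adj u v → vertex u ≢ vertex v
    vertex-vertex u v uv eq =
      ∈S⇒≉ (Adj⇒∈S uv) (κ-diag v u (↑ˡ-injective (suc ∣ R ∣) _ _ (sym eq)))

    edge-edge : ∀ u v w → Adj u v → Adj u w → v ≢ w → edge u v ≢ edge u w
    edge-edge u v w uv uw v≢w eq with v ⊝ u ∈? D | w ⊝ u ∈? D
    ... | yes ∈D | yes ∈D′ = v≢w (⊕-cancelˡ (⊖ u) v w (D-≈ ∈D ∈D′ (≈-cancelˡ u _ _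
          (subst₂ _≈_ (sym (⊕-⊝ u v)) (sym (⊕-⊝ u w))
            (κ-latin u v w (compatible u v ∈D) (compatible u w ∈D′)
              (↑ˡ-injective (suc ∣ R ∣) _ _ eq))))))
    ... | no ∉D  | no ∉D′  =
          edgeᴿ-edgeᴿ u v w (inR uv ∉D) (inR uw ∉D′) v≢w (↑ʳ-injective h _ _ eq)
    ... | yes _  | no _    = ↑ˡ≢↑ʳ _ _ eq
    ... | no _   | yes _   = ↑ˡ≢↑ʳ _ _ (sym eq)

    vertex-edge : ∀ u v → Adj u v → vertex u ≢ edge u v
    vertex-edge u v uv eq with v ⊝ u ∈? D
    -- The vertex colour `κ u u` is treated as the entry of a loop at `u`, so the Latin property
    -- compares it with that of the edge.
    ... | yes ∈D = ∈S⇒≉ (Adj⇒∈S uv)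
          (κ-latin u v u (compatible u v ∈D) (compatible-refl u)
            (↑ˡ-injective (suc ∣ R ∣) _ _ (sym eq)))
    ... | no  _  = ↑ˡ≢↑ʳ _ _ eq

  χ″≤ : χ″ G ≤ h + suc ∣ R ∣
  χ″≤ = proj₂ (χ″-isTotalChromaticNumber G) _ (vertex , edge , isTotalColouring)

  bound : (M : Subset n) → ∣ M ∣ + 2 ≡ h → ∣ M ∣ ≤ ∣ D ∣ → h + suc ∣ R ∣ ≤ Δ G + 3
  bound M ∣M∣+2≡h M≤D = begin
    h + suc ∣ R ∣            ≡⟨ cong (_+ suc ∣ R ∣) ∣M∣+2≡h ⟨
    ∣ M ∣ + 2 + suc ∣ R ∣    ≤⟨ +-monoˡ-≤ (suc ∣ R ∣) (+-monoˡ-≤ 2 M≤D) ⟩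
    ∣ D ∣ + 2 + suc ∣ R ∣    ≡⟨ shuffle (∣ D ∣) (∣ R ∣) ⟩
    ∣ R ∣ + ∣ D ∣ + 3        ≡⟨ cong (_+ 3) (∣p─q∣+∣q∣≡∣p∣ S D D⊆S) ⟩
    ∣ S ∣ + 3                ≤⟨ +-monoˡ-≤ 3 ∣S∣≤Δ ⟩
    Δ G + 3                  ∎
    where
    open ≤-Reasoning
    shuffle : ∀ d r → d + 2 + suc r ≡ r + d + 3
    shuffle = solve-∀

theorem3p3 : (n : ℕ) .{{_ : NonZero n}} →
    2 ∣ n →
    let open ℤₙ n in
    (S : Subset n) (S-cayley : IsCayleySet isGroup S) →
    half ∉ S →
    (M : Subset n) →
    M ⊆ S →
    ∣ M ∣ + 2 ≡ n / 2 →
    (∀ mᵢ mⱼ → mᵢ ∈ M → mⱼ ∈ M → mᵢ ⊕ mⱼ ≢ half) →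
    Generates isGroup (S ─ M) →
    χ″ (circulant S S-cayley) ≤ Δ (circulant S S-cayley) + 3
theorem3p3 n 2∣n S S-cayley half∉S M M⊆S ∣M∣+2≡n/2 M-sums _ =
  ≤-trans χ″≤ (bound M ∣M∣+2≡n/2 (∣M∣≤∣D∣ M M⊆S M-sums))
  where open Circulant n 2∣n (n / 2) refl S S-cayley half∉S
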